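{- The map $\Psi\colon\mathrm{Mat}\to\mathrm{WQSym}$ from matroids to word-quasisymmetric functions is strongly valuative; that is, there is an additive map $\widehat\Psi\colon\mathrm{PS}\to\mathrm{WQSym}$ such that $\Psi(M)=\widehat\Psi(\mathbb 1[P_M])$ for every $d\ge0$ and every matroid $M$ on $[d]$.
   Context: $[d]=\{1,\dots,d\}$, $[0]=\emptyset$. For a matroid $M$ on $[d]$, $f\colon[d]\to\mathbb R$ and a basis $B$ put $f(B)=\sum_{i\in B}f(i)$; $f$ is $M$-generic if there is a unique basis $B$ of $M$ maximizing $f(B)$. Let $w_1,w_2,\dots$ be non-commuting variables and $w_f=w_{f(1)}\cdots w_{f(d)}$ for $f\colon[d]\to\mathbb Z_{\ge1}$. Then $\Psi(M)=\sum_{f} w_f$, the sum over all $M$-generic $f\colon[d]\to\mathbb Z_{\ge 1}$. The set composition type of $f$ is the ordered partition of $[d]$ into the level sets of $f$, listed by increasing value. $\mathrm{WQSym}_d$ is the real vector space of formal series $\sum_{f:[d]\to\mathbb Z_{\ge1}}c_fw_f$ with $c_f=c_g$ whenever $f,g$ have the same set composition type; $\mathrm{WQSym}=\bigoplus_{d\ge 0}\mathrm{WQSym}_d$. $\mathrm{Mat}=\bigoplus_{d\ge0}\mathrm{Mat}_d$, where $\mathrm{Mat}_d$ has basis all matroids on $[d]$, and $\Psi$ is extended linearly. $P_M=\mathrm{conv}\{\mathbb 1_B: B\text{ a basis of }M\}\subset\mathbb R^d$ is the matroid base polytope ($\mathbb 1_B$ the 0/1 indicator vector), and $\mathbb 1[P_M]\colon\mathbb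 R^d\to\{0,1\}$ is its indicator function. $\mathrm{PS}_{d}$ is the additive group of functions $\mathbb R^d\to\mathbb Z$ generated by the functions $\mathbb 1[P_M]$, $M$ a matroid on $[d]$, and $\mathrm{PS}=\bigoplus_{d\ge0}\mathrm{PS}_d$. -}

module Defs where

open import Level using (Level; _⊔_; 0ℓ)
open import Algebra.Bundles using (CommutativeRing; Ring; AbelianGroup)
open import Algebra.Module.Bundles using (LeftModule)
open import Algebra.Module.Morphism.Structures using (module LeftModuleMorphisms)
open import Algebra.Morphism.Structures using (module GroupMorphisms)
import Algebra.Construct.Pointwise as Pointwise
import Algebra.Definitions as Definitions
import Algebra.Definitions.RawMonoid as RawMonoidDefs
import Algebra.Properties.AbelianGroup as AbelianGroupProperties
import Algebra.Properties.CommutativeMonoid.Sum as SumProperties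
import Algebra.Properties.Ring as RingProperties
open import Axiom.ExcludedMiddle using (ExcludedMiddle)
open import Data.Bool.Base using (Bool; true; false; if_then_else_; T)
open import Data.Empty using (⊥-elim)
open import Data.Fin.Base using (Fin; zero; suc)
import Data.Fin.Properties as Fin
open import Data.Fin.Subset as Subset using (Subset; inside; outside; _∈_; _∉_; _∪_; _-_; _─_; ⁅_⁆; ∣_∣)
open import Data.Fin.Subset.Properties
  using (nonempty?; x∈p∪q⁻; x∈p∪q⁺; x∈⁅x⁆; x∈⁅y⁆⇒x≡y; x≢y⇒x∉⁅y⁆; x∈p∧x∉q⇒x∈p─q;
         x∈p∧x≢y⇒x∈p-y; p─q⊆p; p⊂q⇒∣p∣<∣q∣; ⊆-antisym; _∈?_)
open import Data.Integer.Base using (ℤ; +_)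
import Data.Integer.Properties as ℤₚ
open import Data.List.Base using (List; []; _∷_; map; filter; upTo)
open import Data.List.Membership.Propositional using () renaming (_∈_ to _∈ˡ_)
open import Data.List.Membership.Propositional.Properties using (∈-upTo⁺)
open import Data.List.Relation.Unary.All using (All; []; _∷_)
import Data.List.Relation.Unary.All as All
open import Data.List.Relation.Unary.AllPairs using (AllPairs; []; _∷_)
import Data.List.Relation.Unary.AllPairs.Properties as AllPairsₚ
open import Data.List.Relation.Unary.Any using (Any; here; there)
open import Data.Nat.Base as ℕ using (ℕ; zero; suc; z≤n; s≤s; NonZero)
import Data.Nat.Properties as ℕₚ
open import Data.Product.Base using (Σ; ∃; Σ-syntax; ∃-syntax; _×_; _,_; proj₁; proj₂)
open import Data.Product using (∃!)
open import Data.Refinement using (Refinement; value)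
open import Data.Sum.Base using (_⊎_; inj₁; inj₂)
open import Data.Vec.Base using ([]; _∷_; here; there; lookup; tabulate)
open import Data.Vec.Properties using ([]=⇒lookup; lookup⇒[]=; lookup∘tabulate)
import Data.Vec.Functional as Vector
open import Function.Base using (_∘_; case_of_)
open import Relation.Binary.Bundles using (Setoid)
open import Relation.Binary.Core using (Rel)
open import Relation.Binary.PropositionalEquality as ≡ using (_≡_; _≢_; refl)
open import Relation.Binary.Structures using (IsTotalOrder)
open import Relation.Nullary using (Dec; yes; no; ¬_; does; contradiction)
open import Relation.Nullary.Decidable using (dec-true)
open import Relation.Unary using (Pred; Satisfiable)
import Relation.Binary.Reasoning.Setoid as ≈-Reasoning

private
  variable
    c ℓ m ℓm r ℓr s ℓs : Level

-- The standard library has no real numbers.  A complete ordered field is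
-- the reals up to unique isomorphism, so ℝ below is any such structure.

record CompleteOrderedField : Set₁ where
  infix 4 _≤_
  field
    commutativeRing : CommutativeRing 0ℓ 0ℓ
  open CommutativeRing commutativeRing public
  field
    0≉1          : ¬ (0# ≈ 1#)
    invertible   : ∀ {x} → ¬ (x ≈ 0#) → Definitions.Invertible _≈_ 1# _*_ x
    _≤_          : Rel Carrier 0ℓ
    isTotalOrder : IsTotalOrder _≈_ _≤_
    +-monoʳ-≤    : ∀ x {y z} → y ≤ z → x + y ≤ x + z
    *-nonneg     : ∀ {x y} → 0# ≤ x → 0# ≤ y → 0# ≤ x * y

  UpperBound : Pred Carrier 0ℓ → Pred Carrier 0ℓ
  UpperBound S b = ∀ {x} → S x → x ≤ b

  field
    supremum : (S : Pred Carrier 0ℓ) → Satisfiable S → Satisfiable (UpperBound S) →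
               ∃[ s ] UpperBound S s × (∀ {b} → UpperBound S b → s ≤ b)

record Matroid (d : ℕ) : Set where
  field
    basis? : Subset d → Bool

  IsBasis : Subset d → Set
  IsBasis B = T (basis? B)

  field
    nonempty : ∃[ B ] IsBasis B
    exchange : ∀ {A B} → IsBasis A → IsBasis B → ∀ {i} → i ∈ A → i ∉ B →
               ∃[ j ] j ∈ B × j ∉ A × IsBasis ((A - i) ∪ ⁅ j ⁆)

open Matroid using (IsBasis)

-- A matroid is determined by its set of bases; the proofs of the axioms
-- play no role in equality.

matroidSetoid : ℕ → Setoid 0ℓ 0ℓ
matroidSetoid d = record
  { Carrier       = Matroid d
  ; _≈_           = λ M N → ∀ B → Matroid.basis? M B ≡ Matroid.basis? N B
  ; isEquivalence = record
    { refl  = λ _ → refl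
    ; sym   = λ p B → ≡.sym (p B)
    ; trans = λ p q B → ≡.trans (p B) (q B)
    }
  }

ℕ⁺ : Set
ℕ⁺ = Refinement ℕ NonZero

levelSet : ∀ {d} → (Fin d → ℕ⁺) → ℕ → Subset d
levelSet f v = tabulate λ i → does (value (f i) ℕₚ.≟ v)

maxValue : ∀ {d} → (Fin d → ℕ⁺) → ℕ
maxValue f = Vector.foldr (λ v → value v ℕ.⊔_) 0 f

setComposition : ∀ {d} → (Fin d → ℕ⁺) → List (Subset d)
setComposition f = filter nonempty? (map (levelSet f) (upTo (suc (maxValue f))))

data Before {d} (a b : Fin d) : List (Subset d) → Set where
  here  : ∀ {X Xs} → a ∈ X → Any (b ∈_) Xs → Before a b (X ∷ Xs)
  there : ∀ {X Xs} → Before a b Xs → Before a b (X ∷ Xs)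

module _ {d} (f : Fin d → ℕ⁺) where

  blocks : List ℕ → List (Subset d)
  blocks vs = filter nonempty? (map (levelSet f) vs)

  ∈levelSet⁻ : ∀ {i v} → i ∈ levelSet f v → value (f i) ≡ v
  ∈levelSet⁻ {i} {v} i∈ = does⇒ (value (f i) ℕₚ.≟ v)
    (≡.trans (≡.sym (lookup∘tabulate _ i)) ([]=⇒lookup i∈))
    where
    does⇒ : ∀ {A : Set} (A? : Dec A) → does A? ≡ true → A
    does⇒ (yes p) _ = p

  ∈levelSet⁺ : ∀ {i v} → value (f i) ≡ v → i ∈ levelSet f v
  ∈levelSet⁺ {i} {v} p =
    lookup⇒[]= i _ (≡.trans (lookup∘tabulate _ i) (dec-true (value (f i) ℕₚ.≟ v) p))

  later : ∀ {b vs} → Any (b ∈_) (blocks vs) → value (f b) ∈ˡ vs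
  later {b} {v ∷ vs} b∈ with nonempty? (levelSet f v)
  later {b} {v ∷ vs} b∈         | no  _ = there (later b∈)
  later {b} {v ∷ vs} (here p)   | yes _ = here (∈levelSet⁻ p)
  later {b} {v ∷ vs} (there b∈) | yes _ = there (later b∈)

  later⁺ : ∀ {b vs} → value (f b) ∈ˡ vs → Any (b ∈_) (blocks vs)
  later⁺ {b} {v ∷ vs} b∈ with nonempty? (levelSet f v)
  later⁺ {b} {v ∷ vs} (here p)   | no ¬n = contradiction (b , ∈levelSet⁺ p) ¬n
  later⁺ {b} {v ∷ vs} (there b∈) | no _  = later⁺ b∈
  later⁺ {b} {v ∷ vs} (here p)   | yes _ = here (∈levelSet⁺ p)
  later⁺ {b} {v ∷ vs} (there b∈) | yes _ = there (later⁺ b∈)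

  before⇒< : ∀ {a b vs} → AllPairs ℕ._<_ vs → Before a b (blocks vs) → value (f a) ℕ.< value (f b)
  before⇒< {vs = v ∷ vs} (v< ∷ ps) q with nonempty? (levelSet f v)
  before⇒< {vs = v ∷ vs} (v< ∷ ps) q            | no  _ = before⇒< ps q
  before⇒< {vs = v ∷ vs} (v< ∷ ps) (here a∈ b∈) | yes _ =
    ≡.subst (ℕ._< _) (≡.sym (∈levelSet⁻ a∈)) (All.lookup v< (later b∈))
  before⇒< {vs = v ∷ vs} (v< ∷ ps) (there q)    | yes _ = before⇒< ps q

  <⇒before : ∀ {a b vs} → AllPairs ℕ._<_ vs → value (f a) ∈ˡ vs → value (f b) ∈ˡ vs →
             value (f a) ℕ.< value (f b) → Before a b (blocks vs)
  <⇒before {vs = v ∷ vs} (v< ∷ ps) a∈ b∈ a<b with nonempty? (levelSet f v)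
  <⇒before {a} {vs = v ∷ vs} (v< ∷ ps) (here p) b∈ a<b | no ¬n =
    contradiction (a , ∈levelSet⁺ p) ¬n
  <⇒before {vs = v ∷ vs} (v< ∷ ps) (here p) (here q) a<b | yes _ =
    contradiction a<b (ℕₚ.<-irrefl (≡.trans p (≡.sym q)))
  <⇒before {vs = v ∷ vs} (v< ∷ ps) (here p) (there b∈) a<b | yes _ =
    here (∈levelSet⁺ p) (later⁺ b∈)
  <⇒before {b = b} {vs = v ∷ vs} (v< ∷ ps) (there a∈) (here q) a<b | _ =
    contradiction (≡.subst (ℕ._< _) (≡.sym q) (All.lookup v< a∈)) (ℕₚ.<-asym a<b)
  <⇒before {vs = v ∷ vs} (v< ∷ ps) (there a∈) (there b∈) a<b | no _  = <⇒before ps a∈ b∈ a<b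
  <⇒before {vs = v ∷ vs} (v< ∷ ps) (there a∈) (there b∈) a<b | yes _ =
    there (<⇒before ps a∈ b∈ a<b)

upTo-sorted : ∀ n → AllPairs ℕ._<_ (upTo n)
upTo-sorted n = AllPairsₚ.applyUpTo⁺₁ _ n (λ i<j _ → i<j)

≤-maxValue : ∀ {d} (f : Fin d → ℕ⁺) i → value (f i) ℕ.≤ maxValue f
≤-maxValue f zero    = ℕₚ.m≤m⊔n _ _
≤-maxValue f (suc i) = ℕₚ.≤-trans (≤-maxValue (f ∘ suc) i) (ℕₚ.m≤n⊔m (value (f zero)) _)

setComposition-≤ : ∀ {d} (f g : Fin d → ℕ⁺) → setComposition f ≡ setComposition g →
                   ∀ i j → value (g i) ℕ.≤ value (g j) → value (f i) ℕ.≤ value (f j)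
setComposition-≤ f g eq i j gi≤gj with value (f i) ℕₚ.≤? value (f j)
... | yes fi≤fj = fi≤fj
... | no  fi≰fj = contradiction gi≤gj (ℕₚ.<⇒≱ gj<gi)
  where
  before : Before j i (setComposition f)
  before = <⇒before f (upTo-sorted _) (∈-upTo⁺ (s≤s (≤-maxValue f j)))
                    (∈-upTo⁺ (s≤s (≤-maxValue f i))) (ℕₚ.≰⇒> fi≰fj)
  gj<gi : value (g j) ℕ.< value (g i)
  gj<gi = before⇒< g (upTo-sorted _) (≡.subst (Before j i) eq before)

-- Elements of the generated subgroup are compared by their underlying
-- elements only, never by how they are expressed in the generators.

module _ (G : AbelianGroup c ℓ) where
  open AbelianGroup G

  data Generated (P : Pred Carrier s) : Pred Carrier (c ⊔ ℓ ⊔ s) where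
    generator : ∀ {x} → P x → Generated P x
    ε-closed  : Generated P ε
    ∙-closed  : ∀ {x y} → Generated P x → Generated P y → Generated P (x ∙ y)
    ⁻¹-closed : ∀ {x} → Generated P x → Generated P (x ⁻¹)
    ≈-closed  : ∀ {x y} → x ≈ y → Generated P x → Generated P y

  generatedSubgroup : Pred Carrier s → AbelianGroup (c ⊔ ℓ ⊔ s) ℓ
  generatedSubgroup P = record
    { Carrier = Σ Carrier (Generated P)
    ; _≈_     = λ x y → proj₁ x ≈ proj₁ y
    ; _∙_     = λ (x , p) (y , q) → x ∙ y , ∙-closed p q
    ; ε       = ε , ε-closed
    ; _⁻¹     = λ (x , p) → x ⁻¹ , ⁻¹-closed p
    ; isAbelianGroup = record
      { isGroup = record
        { isMonoid = record
          { isSemigroup = record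
            { isMagma = record
              { isEquivalence = record
                { refl = AbelianGroup.refl G ; sym = sym ; trans = trans }
              ; ∙-cong = ∙-cong
              }
            ; assoc = λ _ _ _ → assoc _ _ _
            }
          ; identity = (λ _ → identityˡ _) , (λ _ → identityʳ _)
          }
        ; inverse = (λ _ → inverseˡ _) , (λ _ → inverseʳ _)
        ; ⁻¹-cong = ⁻¹-cong
        }
      ; comm = λ _ _ → comm _ _
      }
    }

module _ (G : ℕ → AbelianGroup c ℓ) where
  private module G d = AbelianGroup (G d)

  record FinitelySupported : Set (c ⊔ ℓ) where
    field
      component : ∀ d → G.Carrier d
      bound     : ℕ
      vanishes  : ∀ {d} → bound ℕ.≤ d → G._≈_ d (component d) (G.ε d)
  open FinitelySupported

  ⨁ᴳ : AbelianGroup (c ⊔ ℓ) ℓ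
  ⨁ᴳ = record
    { Carrier = FinitelySupported
    ; _≈_     = λ x y → ∀ d → G._≈_ d (component x d) (component y d)
    ; _∙_     = λ x y → record
      { component = λ d → G._∙_ d (component x d) (component y d)
      ; bound     = bound x ℕ.⊔ bound y
      ; vanishes  = λ {d} b≤d → G.trans d
          (G.∙-cong d (vanishes x (ℕₚ.≤-trans (ℕₚ.m≤m⊔n _ _) b≤d))
                      (vanishes y (ℕₚ.≤-trans (ℕₚ.m≤n⊔m (bound x) _) b≤d)))
          (G.identityˡ d (G.ε d))
      }
    ; ε       = record { component = G.ε ; bound = 0 ; vanishes = λ {d} _ → G.refl d }
    ; _⁻¹     = λ x → record
      { component = λ d → G._⁻¹ d (component x d)
      ; bound     = bound x
      ; vanishes  = λ {d} b≤d → G.trans d (G.⁻¹-cong d (vanishes x b≤d))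
                                          (AbelianGroupProperties.ε⁻¹≈ε (G d))
      }
    ; isAbelianGroup = record
      { isGroup = record
        { isMonoid = record
          { isSemigroup = record
            { isMagma = record
              { isEquivalence = record
                { refl  = λ d → G.refl d
                ; sym   = λ p d → G.sym d (p d)
                ; trans = λ p q d → G.trans d (p d) (q d)
                }
              ; ∙-cong = λ p q d → G.∙-cong d (p d) (q d)
              }
            ; assoc = λ _ _ _ d → G.assoc d _ _ _
            }
          ; identity = (λ _ d → G.identityˡ d _) , (λ _ d → G.identityʳ d _)
          }
        ; inverse = (λ _ d → G.inverseˡ d _) , (λ _ d → G.inverseʳ d _)
        ; ⁻¹-cong = λ p d → G.⁻¹-cong d (p d)
        }
      ; comm = λ _ _ d → G.comm d _ _
      }
    }

  at : ∀ {d e} → Dec (d ≡ e) → G.Carrier d → G.Carrier e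
  at     (yes refl) x = x
  at {e = e} (no _) _ = G.ε e

  at-≢ : ∀ {d e} (d≟e : Dec (d ≡ e)) x → d ≢ e → G._≈_ e (at d≟e x) (G.ε e)
  at-≢         (yes p) x d≢e = contradiction p d≢e
  at-≢ {e = e} (no _)  x d≢e = G.refl e

  ι : ∀ d → G.Carrier d → FinitelySupported
  ι d x = record
    { component = λ e → at (d ℕₚ.≟ e) x
    ; bound     = suc d
    ; vanishes  = λ {e} d<e → at-≢ (d ℕₚ.≟ e) x (ℕₚ.<⇒≢ d<e)
    }

module _ {R : Ring r ℓr} where

  record LinearMap (V : LeftModule R c ℓ) (W : LeftModule R m ℓm)
                   : Set (r ⊔ c ⊔ ℓ ⊔ m ⊔ ℓm) where
    open LeftModuleMorphisms (LeftModule.rawLeftModule V) (LeftModule.rawLeftModule W)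
    field
      ⟦_⟧          : LeftModule.Carrierᴹ V → LeftModule.Carrierᴹ W
      isLinear     : IsLeftModuleHomomorphism ⟦_⟧
    open IsLeftModuleHomomorphism isLinear public

  underlying : LeftModule R m ℓm → AbelianGroup m ℓm
  underlying = LeftModule.+ᴹ-abelianGroup

  ⨁ : (ℕ → LeftModule R m ℓm) → LeftModule R (m ⊔ ℓm) ℓm
  ⨁ V = record
    { Carrierᴹ = Carrier
    ; _≈ᴹ_     = _≈_
    ; _+ᴹ_     = _∙_
    ; _*ₗ_     = λ k x → record
      { component = λ d → V._*ₗ_ d k (component x d)
      ; bound     = bound x
      ; vanishes  = λ {d} b≤d → V.≈ᴹ-trans d (V.*ₗ-congˡ d (vanishes x b≤d)) (V.*ₗ-zeroʳ d k)
      }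
    ; 0ᴹ       = ε
    ; -ᴹ_      = _⁻¹
    ; isLeftModule = record
      { isLeftSemimodule = record
        { +ᴹ-isCommutativeMonoid = isCommutativeMonoid
        ; isPreleftSemimodule = record
          { *ₗ-cong      = λ p q d → V.*ₗ-cong d p (q d)
          ; *ₗ-zeroˡ     = λ _ d → V.*ₗ-zeroˡ d _
          ; *ₗ-distribʳ  = λ _ _ _ d → V.*ₗ-distribʳ d _ _ _
          ; *ₗ-identityˡ = λ _ d → V.*ₗ-identityˡ d _
          ; *ₗ-assoc     = λ _ _ _ d → V.*ₗ-assoc d _ _ _
          ; *ₗ-zeroʳ     = λ _ d → V.*ₗ-zeroʳ d _
          ; *ₗ-distribˡ  = λ _ _ _ d → V.*ₗ-distribˡ d _ _ _
          }
        }
      ; -ᴹ‿cong    = λ {x} {y} → ⁻¹-cong {x} {y}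
      ; -ᴹ‿inverse = inverse
      }
    }
    where
    module V d = LeftModule (V d)
    open AbelianGroup (⨁ᴳ (λ d → underlying (V d)))
    open FinitelySupported

  ⨁-map : {V : ℕ → LeftModule R c ℓ} {W : ℕ → LeftModule R m ℓm} →
          (∀ d → LinearMap (V d) (W d)) → LinearMap (⨁ V) (⨁ W)
  ⨁-map {V = V} {W} φ = record
    { ⟦_⟧ = λ x → record
      { component = λ d → φ.⟦_⟧ d (component x d)
      ; bound     = bound x
      ; vanishes  = λ {d} b≤d → LeftModule.≈ᴹ-trans (W d) (φ.⟦⟧-cong d (vanishes x b≤d)) (φ.0ᴹ-homo d)
      }
    ; isLinear = record
      { +ᴹ-isGroupHomomorphism = record
        { isMonoidHomomorphism = record
          { isMagmaHomomorphism = record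
            { isRelHomomorphism = record { cong = λ p d → φ.⟦⟧-cong d (p d) }
            ; homo = λ _ _ d → φ.+ᴹ-homo d _ _
            }
          ; ε-homo = λ d → φ.0ᴹ-homo d
          }
        ; ⁻¹-homo = λ _ d → φ.-ᴹ-homo d _
        }
      ; *ₗ-homo = λ _ _ d → φ.*ₗ-homo d _ _
      }
    }
    where
    module φ d = LinearMap (φ d)
    open FinitelySupported

-- The module with basis S: formal linear combinations of elements of S
-- modulo the congruence generated by the module axioms.

module _ (R : Ring r ℓr) (S : Setoid s ℓs) where
  private
    module R = Ring R
    module S = Setoid S

  infixl 6 _⊕_
  infixr 7 _⊛_
  infix  8 ⊖_
  infix  4 _≋_

  data Combination : Set (r ⊔ s) where
    [_] : S.Carrier → Combination
    𝟘   : Combination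
    _⊕_ : Combination → Combination → Combination
    ⊖_  : Combination → Combination
    _⊛_ : R.Carrier → Combination → Combination

  data _≋_ : Rel Combination (r ⊔ ℓr ⊔ s ⊔ ℓs) where
    ≋-refl    : ∀ {x} → x ≋ x
    ≋-sym     : ∀ {x y} → x ≋ y → y ≋ x
    ≋-trans   : ∀ {x y z} → x ≋ y → y ≋ z → x ≋ z
    [_]-cong  : ∀ {a b} → a S.≈ b → [ a ] ≋ [ b ]
    ⊕-cong    : ∀ {x x′ y y′} → x ≋ x′ → y ≋ y′ → x ⊕ y ≋ x′ ⊕ y′
    ⊖-cong    : ∀ {x y} → x ≋ y → ⊖ x ≋ ⊖ y
    ⊛-cong    : ∀ {k l x y} → k R.≈ l → x ≋ y → k ⊛ x ≋ l ⊛ y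
    ⊕-assoc   : ∀ x y z → (x ⊕ y) ⊕ z ≋ x ⊕ (y ⊕ z)
    ⊕-comm    : ∀ x y → x ⊕ y ≋ y ⊕ x
    ⊕-idˡ     : ∀ x → 𝟘 ⊕ x ≋ x
    ⊖-invˡ    : ∀ x → ⊖ x ⊕ x ≋ 𝟘
    ⊛-distˡ   : ∀ k x y → k ⊛ (x ⊕ y) ≋ k ⊛ x ⊕ k ⊛ y
    ⊛-distʳ   : ∀ x k l → (k R.+ l) ⊛ x ≋ k ⊛ x ⊕ l ⊛ x
    ⊛-assoc   : ∀ k l x → (k R.* l) ⊛ x ≋ k ⊛ (l ⊛ x)
    ⊛-idˡ     : ∀ x → R.1# ⊛ x ≋ x
    ⊛-zeroˡ   : ∀ x → R.0# ⊛ x ≋ 𝟘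
    ⊛-zeroʳ   : ∀ k → k ⊛ 𝟘 ≋ 𝟘

  freeModule : LeftModule R (r ⊔ s) (r ⊔ ℓr ⊔ s ⊔ ℓs)
  freeModule = record
    { Carrierᴹ = Combination
    ; _≈ᴹ_     = _≋_
    ; _+ᴹ_     = _⊕_
    ; _*ₗ_     = _⊛_
    ; 0ᴹ       = 𝟘
    ; -ᴹ_      = ⊖_
    ; isLeftModule = record
      { isLeftSemimodule = record
        { +ᴹ-isCommutativeMonoid = record
          { isMonoid = record
            { isSemigroup = record
              { isMagma = record
                { isEquivalence = record { refl = ≋-refl ; sym = ≋-sym ; trans = ≋-trans }
                ; ∙-cong        = ⊕-cong
                }
              ; assoc = ⊕-assoc
              }
            ; identity = ⊕-idˡ , λ x → ≋-trans (⊕-comm x 𝟘) (⊕-idˡ x)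
            }
          ; comm = ⊕-comm
          }
        ; isPreleftSemimodule = record
          { *ₗ-cong      = ⊛-cong
          ; *ₗ-zeroˡ     = ⊛-zeroˡ
          ; *ₗ-distribʳ  = ⊛-distʳ
          ; *ₗ-identityˡ = ⊛-idˡ
          ; *ₗ-assoc     = ⊛-assoc
          ; *ₗ-zeroʳ     = ⊛-zeroʳ
          ; *ₗ-distribˡ  = ⊛-distˡ
          }
        }
      ; -ᴹ‿cong    = ⊖-cong
      ; -ᴹ‿inverse = ⊖-invˡ , λ x → ≋-trans (⊕-comm x (⊖ x)) (⊖-invˡ x)
      }
    }

  module _ (V : LeftModule R m ℓm) where
    private module V = LeftModule V

    extend : (φ : S.Carrier → V.Carrierᴹ) → (∀ {a b} → a S.≈ b → φ a V.≈ᴹ φ b) →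
             LinearMap freeModule V
    extend φ φ-cong = record
      { ⟦_⟧ = eval
      ; isLinear = record
        { +ᴹ-isGroupHomomorphism = record
          { isMonoidHomomorphism = record
            { isMagmaHomomorphism = record
              { isRelHomomorphism = record { cong = eval-cong }
              ; homo = λ _ _ → V.≈ᴹ-refl
              }
            ; ε-homo = V.≈ᴹ-refl
            }
          ; ⁻¹-homo = λ _ → V.≈ᴹ-refl
          }
        ; *ₗ-homo = λ _ _ → V.≈ᴹ-refl
        }
      }
      where
      eval : Combination → V.Carrierᴹ
      eval [ a ]   = φ a
      eval 𝟘       = V.0ᴹ
      eval (x ⊕ y) = eval x V.+ᴹ eval y
      eval (⊖ x)   = V.-ᴹ eval x
      eval (k ⊛ x) = k V.*ₗ eval x

      eval-cong : ∀ {x y} → x ≋ y → eval x V.≈ᴹ eval y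
      eval-cong ≋-refl          = V.≈ᴹ-refl
      eval-cong (≋-sym p)       = V.≈ᴹ-sym (eval-cong p)
      eval-cong (≋-trans p q)   = V.≈ᴹ-trans (eval-cong p) (eval-cong q)
      eval-cong [ p ]-cong      = φ-cong p
      eval-cong (⊕-cong p q)    = V.+ᴹ-cong (eval-cong p) (eval-cong q)
      eval-cong (⊖-cong p)      = V.-ᴹ‿cong (eval-cong p)
      eval-cong (⊛-cong p q)    = V.*ₗ-cong p (eval-cong q)
      eval-cong (⊕-assoc x y z) = V.+ᴹ-assoc _ _ _
      eval-cong (⊕-comm x y)    = V.+ᴹ-comm _ _
      eval-cong (⊕-idˡ x)       = V.+ᴹ-identityˡ _
      eval-cong (⊖-invˡ x)      = V.-ᴹ‿inverseˡ _
      eval-cong (⊛-distˡ k x y) = V.*ₗ-distribˡ _ _ _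
      eval-cong (⊛-distʳ x k l) = V.*ₗ-distribʳ _ _ _
      eval-cong (⊛-assoc k l x) = V.*ₗ-assoc _ _ _
      eval-cong (⊛-idˡ x)       = V.*ₗ-identityˡ _
      eval-cong (⊛-zeroˡ x)     = V.*ₗ-zeroˡ _
      eval-cong (⊛-zeroʳ k)     = V.*ₗ-zeroʳ _

module _ (ℝ : CompleteOrderedField) where
  open CompleteOrderedField ℝ hiding (refl)
  open SumProperties +-commutativeMonoid using (sum)

  weight : ∀ {d} → (Fin d → Carrier) → Subset d → Carrier
  weight f B = sum λ i → if lookup B i then f i else 0#

  IsMaxBasis : ∀ {d} → Matroid d → (Fin d → Carrier) → Subset d → Set
  IsMaxBasis M f B = IsBasis M B × (∀ {B′} → IsBasis M B′ → weight f B′ ≤ weight f B)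

  Generic : ∀ {d} → Matroid d → (Fin d → Carrier) → Set
  Generic M f = ∃! _≡_ (IsMaxBasis M f)

  fromℕ : ℕ → Carrier
  fromℕ n = n ×# 1#
    where open RawMonoidDefs +-rawMonoid using () renaming (_×_ to _×#_)

  ℝ^ : ℕ → Set
  ℝ^ d = Fin d → Carrier

  record Conv {d} (S : Pred (ℝ^ d) 0ℓ) (x : ℝ^ d) : Set where
    field
      size        : ℕ
      point       : Fin size → ℝ^ d
      coefficient : Fin size → Carrier
      point∈S     : ∀ k → S (point k)
      nonneg      : ∀ k → 0# ≤ coefficient k
      sum≈1       : sum coefficient ≈ 1#
      combination : ∀ i → x i ≈ sum λ k → coefficient k * point k i

  indicatorVector : ∀ {d} → Subset d → ℝ^ d
  indicatorVector B i = if lookup B i then 1# else 0#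

  BasePolytope : ∀ {d} → Matroid d → Pred (ℝ^ d) 0ℓ
  BasePolytope M = Conv λ x → ∃[ B ] IsBasis M B × (∀ i → x i ≈ indicatorVector B i)

∈─⇒∉ : ∀ {d} (p q : Subset d) {x} → x ∈ p ─ q → x ∉ q
∈─⇒∉ (s ∷ p) (inside  ∷ q) {zero}  () _
∈─⇒∉ (s ∷ p) (outside ∷ q) {zero}  _  ()
∈─⇒∉ (s ∷ p) (inside  ∷ q) {suc x} (there h) (there x∈q) = ∈─⇒∉ p q h x∈q
∈─⇒∉ (s ∷ p) (outside ∷ q) {suc x} (there h) (there x∈q) = ∈─⇒∉ p q h x∈q

module _ {d : ℕ} where

  swap : Subset d → Fin d → Fin d → Subset d
  swap A i j = (A - i) ∪ ⁅ j ⁆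

  ∈swap-new : ∀ {A i} j → j ∈ swap A i j
  ∈swap-new j = x∈p∪q⁺ (inj₂ (x∈⁅x⁆ j))

  ∈swap-old : ∀ {A i j x} → x ∈ A → x ≢ i → x ∈ swap A i j
  ∈swap-old x∈A x≢i = x∈p∪q⁺ (inj₁ (x∈p∧x≢y⇒x∈p-y x∈A x≢i))

  ∈swap⁻ : ∀ {A i j x} → x ∈ swap A i j → (x ∈ A × x ≢ i) ⊎ x ≡ j
  ∈swap⁻ {A} {i} {j} {x} x∈ with x∈p∪q⁻ (A - i) ⁅ j ⁆ x∈
  ... | inj₁ h = inj₁ (p─q⊆p A ⁅ i ⁆ h , λ { refl → ∈─⇒∉ A ⁅ i ⁆ h (x∈⁅x⁆ i) })
  ... | inj₂ h = inj₂ (x∈⁅y⁆⇒x≡y j h)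

  ─-shrinks : ∀ {A B i j} → i ∈ A → i ∉ B → j ∈ B → ∣ swap A i j ─ B ∣ ℕ.< ∣ A ─ B ∣
  ─-shrinks {A} {B} {i} {j} i∈A i∉B j∈B =
    p⊂q⇒∣p∣<∣q∣ (sub , i , x∈p∧x∉q⇒x∈p─q i∈A i∉B , i∉)
    where
    sub : ∀ {x} → x ∈ swap A i j ─ B → x ∈ A ─ B
    sub x∈ with ∈swap⁻ {A} (p─q⊆p (swap A i j) B x∈)
    ... | inj₁ (x∈A , _) = x∈p∧x∉q⇒x∈p─q x∈A (∈─⇒∉ (swap A i j) B x∈)
    ... | inj₂ refl      = contradiction j∈B (∈─⇒∉ (swap A i j) B x∈)
    i∉ : i ∉ swap A i j ─ B
    i∉ i∈ with ∈swap⁻ {A} (p─q⊆p (swap A i j) B i∈)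
    ... | inj₁ (_ , i≢i) = i≢i refl
    ... | inj₂ refl      = i∉B j∈B

  ─-shrinks′ : ∀ {A B i j} → i ∈ A → i ∉ B → j ∈ B → j ∉ A → ∣ B ─ swap A i j ∣ ℕ.< ∣ B ─ A ∣
  ─-shrinks′ {A} {B} {i} {j} i∈A i∉B j∈B j∉A =
    p⊂q⇒∣p∣<∣q∣ (sub , j , x∈p∧x∉q⇒x∈p─q j∈B j∉A ,
                 λ j∈ → ∈─⇒∉ B (swap A i j) j∈ (∈swap-new {A} {i} j))
    where
    sub : ∀ {x} → x ∈ B ─ swap A i j → x ∈ B ─ A
    sub {x} x∈ = x∈p∧x∉q⇒x∈p─q x∈B λ x∈A →
      ∈─⇒∉ B (swap A i j) x∈ (∈swap-old x∈A λ { refl → i∉B x∈B })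
      where
      x∈B : x ∈ B
      x∈B = p─q⊆p B (swap A i j) x∈

module _ (em : ExcludedMiddle 0ℓ) {d} (M : Matroid d) where
  open Matroid M using (exchange)

  exchange-onto′ : ∀ n {B D X : Subset d} {e} → IsBasis M B → IsBasis M X →
    (∀ {x} → x ∈ B → x ∈ D → x ∈ X) → e ∈ X → e ∉ B → ∣ X ─ B ∣ ℕ.≤ n →
    ∃[ i ] i ∈ B × i ∉ D × IsBasis M (swap B i e)
  exchange-onto′ n {B} {D} {X} {e} bB bX B∩D⊆X e∈X e∉B size
    with em {∃[ x ] x ∈ X × x ∉ B × x ≢ e}
  exchange-onto′ n {B} {D} {X} {e} bB bX B∩D⊆X e∈X e∉B size | no none
    with exchange bX bB e∈X e∉B
  ... | i , i∈B , i∉X , _ with exchange bB bX i∈B i∉X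
  ... | y , y∈X , y∉B , bS with em {y ≡ e}
  ... | yes refl = i , i∈B , (λ i∈D → i∉X (B∩D⊆X i∈B i∈D)) , bS
  ... | no  y≢e  = contradiction (y , y∈X , y∉B , y≢e) none
  exchange-onto′ zero {B} {X = X} bB bX B∩D⊆X e∈X e∉B size | yes (x , x∈X , x∉B , x≢e)
    with exchange bX bB x∈X x∉B
  ... | y , y∈B , _ , _ = contradiction (ℕₚ.<-≤-trans (─-shrinks x∈X x∉B y∈B) size) λ ()
  exchange-onto′ (suc n) {B} {X = X} bB bX B∩D⊆X e∈X e∉B size | yes (x , x∈X , x∉B , x≢e)
    with exchange bX bB x∈X x∉B
  ... | y , y∈B , _ , bX′ = exchange-onto′ n bB bX′
    (λ z∈B z∈D → ∈swap-old (B∩D⊆X z∈B z∈D) λ { refl → x∉B z∈B })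
    (∈swap-old e∈X (x≢e ∘ ≡.sym)) e∉B
    (ℕₚ.≤-pred (ℕₚ.≤-trans (─-shrinks x∈X x∉B y∈B) size))

  exchange-onto : ∀ {B D e} → IsBasis M B → IsBasis M D → e ∈ D → e ∉ B →
                  ∃[ i ] i ∈ B × i ∉ D × IsBasis M (swap B i e)
  exchange-onto bB bD e∈D e∉B = exchange-onto′ _ bB bD (λ _ x∈D → x∈D) e∈D e∉B ℕₚ.≤-refl

module _ (ℝ : CompleteOrderedField) where
  open CompleteOrderedField ℝ hiding (refl; _-_; zero)
  private module ℝ = CompleteOrderedField ℝ
  open SumProperties +-commutativeMonoid using (sum; sum-cong-≋; ∑-distrib-+)
  open IsTotalOrder isTotalOrder
    using (total; antisym; ≤-respʳ-≈; ≤-respˡ-≈)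
    renaming (refl to ≤-refl; trans to ≤-trans; reflexive to ≤-reflexive)

  +-monoˡ-≤ : ∀ x {y z} → y ≤ z → y + x ≤ z + x
  +-monoˡ-≤ x y≤z = ≤-respˡ-≈ (+-comm x _) (≤-respʳ-≈ (+-comm x _) (+-monoʳ-≤ x y≤z))

  +-cancelˡ-≤ : ∀ x {y z} → x + y ≤ x + z → y ≤ z
  +-cancelˡ-≤ x {y} {z} p = ≤-respˡ-≈ (cancel y) (≤-respʳ-≈ (cancel z) (+-monoʳ-≤ (- x) p))
    where
    cancel : ∀ w → - x + (x + w) ≈ w
    cancel w = trans (sym (+-assoc _ _ _)) (trans (+-congʳ (-‿inverseˡ x)) (+-identityˡ w))

  +-cancelʳ-≤ : ∀ x {y z} → y + x ≤ z + x → y ≤ z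
  +-cancelʳ-≤ x p = +-cancelˡ-≤ x (≤-respˡ-≈ (+-comm _ x) (≤-respʳ-≈ (+-comm _ x) p))

  0≤1 : 0# ≤ 1#
  0≤1 with total 0# 1#
  ... | inj₁ p = p
  ... | inj₂ p = ≤-respʳ-≈ square (*-nonneg 0≤-1 0≤-1)
    where
    open RingProperties ring using (-‿distribˡ-*; -‿involutive)
    0≤-1 : 0# ≤ - 1#
    0≤-1 = +-cancelˡ-≤ 1# (≤-respˡ-≈ (sym (+-identityʳ 1#)) (≤-respʳ-≈ (sym (-‿inverseʳ 1#)) p))
    square : - 1# * - 1# ≈ 1#
    square = trans (sym (-‿distribˡ-* 1# (- 1#)))
                   (trans (-‿cong (*-identityˡ (- 1#))) (-‿involutive 1#))

  fromℕ-nonneg : ∀ n → 0# ≤ fromℕ ℝ n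
  fromℕ-nonneg zero    = ≤-refl
  fromℕ-nonneg (suc n) =
    ≤-trans 0≤1 (≤-respˡ-≈ (+-identityʳ 1#) (+-monoʳ-≤ 1# (fromℕ-nonneg n)))

  fromℕ-mono-≤ : ∀ {m n} → m ℕ.≤ n → fromℕ ℝ m ≤ fromℕ ℝ n
  fromℕ-mono-≤ {n = n} z≤n = fromℕ-nonneg n
  fromℕ-mono-≤ (s≤s m≤n)   = +-monoʳ-≤ 1# (fromℕ-mono-≤ m≤n)

  fromℕ-cancel-≤ : ∀ m n → fromℕ ℝ m ≤ fromℕ ℝ n → m ℕ.≤ n
  fromℕ-cancel-≤ zero    n       _ = z≤n
  fromℕ-cancel-≤ (suc m) zero    p = contradiction (antisym 0≤1 1≤0) 0≉1
    where
    1≤0 : 1# ≤ 0#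
    1≤0 = ≤-trans (≤-respˡ-≈ (+-identityʳ 1#) (+-monoʳ-≤ 1# (fromℕ-nonneg m))) p
  fromℕ-cancel-≤ (suc m) (suc n) p = s≤s (fromℕ-cancel-≤ m n (+-cancelˡ-≤ 1# p))

  entry : ∀ {d} → (Fin d → Carrier) → Subset d → Fin d → Carrier
  entry f B i = if lookup B i then f i else 0#

  entry-∈ : ∀ {d} (f : Fin d → Carrier) {B i} → i ∈ B → entry f B i ≈ f i
  entry-∈ f {B} {i} i∈B rewrite []=⇒lookup i∈B = ℝ.refl

  entry-∉ : ∀ {d} (f : Fin d → Carrier) {B i} → i ∉ B → entry f B i ≈ 0#
  entry-∉ f {B} {i} i∉B with lookup B i in eq
  ... | true  = contradiction (lookup⇒[]= i B eq) i∉B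
  ... | false = ℝ.refl

  weight-∅ : ∀ {d} (f : Fin d → Carrier) → weight ℝ f (Subset.⊥) ≈ 0#
  weight-∅ {zero}  f = ℝ.refl
  weight-∅ {suc d} f = trans (+-identityˡ _) (weight-∅ (f ∘ suc))

  weight-⁅⁆ : ∀ {d} (f : Fin d → Carrier) i → weight ℝ f ⁅ i ⁆ ≈ f i
  weight-⁅⁆ f zero    = trans (+-congˡ (weight-∅ (f ∘ suc))) (+-identityʳ _)
  weight-⁅⁆ f (suc i) = trans (+-identityˡ _) (weight-⁅⁆ (f ∘ suc) i)

  weight-swap : ∀ {d} (f : Fin d → Carrier) {A i j} → i ∈ A → j ∉ A →
                weight ℝ f (swap A i j) + f i ≈ weight ℝ f A + f j
  weight-swap f {A} {i} {j} i∈A j∉A = begin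
    weight ℝ f S + f i                             ≈⟨ +-congˡ (weight-⁅⁆ f i) ⟨
    weight ℝ f S + weight ℝ f ⁅ i ⁆                ≈⟨ ∑-distrib-+ (entry f S) (entry f ⁅ i ⁆) ⟨
    sum (λ x → entry f S x + entry f ⁅ i ⁆ x)      ≈⟨ sum-cong-≋ pointwise ⟩
    sum (λ x → entry f A x + entry f ⁅ j ⁆ x)      ≈⟨ ∑-distrib-+ (entry f A) (entry f ⁅ j ⁆) ⟩
    weight ℝ f A + weight ℝ f ⁅ j ⁆                ≈⟨ +-congˡ (weight-⁅⁆ f j) ⟩
    weight ℝ f A + f j                             ∎
    where
    open ≈-Reasoning setoid
    S = swap A i j
    pointwise : ∀ x → entry f S x + entry f ⁅ i ⁆ x ≈ entry f A x + entry f ⁅ j ⁆ x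
    pointwise x with x Fin.≟ i | x Fin.≟ j | x ∈? A
    ... | yes refl | yes refl | _ = contradiction i∈A j∉A
    ... | yes refl | no x≢j | _ = trans
      (+-cong (entry-∉ f i∉S) (entry-∈ f (x∈⁅x⁆ i)))
      (trans (+-comm _ _) (sym (+-cong (entry-∈ f i∈A) (entry-∉ f (x≢y⇒x∉⁅y⁆ x≢j)))))
      where
      i∉S : i ∉ S
      i∉S i∈ with ∈swap⁻ {A = A} i∈
      ... | inj₁ (_ , i≢i) = i≢i refl
      ... | inj₂ i≡j       = x≢j i≡j
    ... | no x≢i | yes refl | _ = trans
      (+-cong (entry-∈ f (∈swap-new {A = A} {i} j)) (entry-∉ f (x≢y⇒x∉⁅y⁆ x≢i)))
      (trans (+-comm _ _) (sym (+-cong (entry-∉ f j∉A) (entry-∈ f (x∈⁅x⁆ j)))))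
    ... | no x≢i | no x≢j | yes x∈A = +-cong
      (trans (entry-∈ f (∈swap-old {A = A} x∈A x≢i)) (sym (entry-∈ f x∈A)))
      (trans (entry-∉ f (x≢y⇒x∉⁅y⁆ x≢i)) (sym (entry-∉ f (x≢y⇒x∉⁅y⁆ x≢j))))
    ... | no x≢i | no x≢j | no x∉A = +-cong
      (trans (entry-∉ f x∉S) (sym (entry-∉ f x∉A)))
      (trans (entry-∉ f (x≢y⇒x∉⁅y⁆ x≢i)) (sym (entry-∉ f (x≢y⇒x∉⁅y⁆ x≢j))))
      where
      x∉S : x ∉ S
      x∉S x∈ with ∈swap⁻ {A = A} x∈
      ... | inj₁ (x∈A , _) = x∉A x∈A
      ... | inj₂ x≡j       = x≢j x≡j

  weight-≤-swap : ∀ {d} (f : Fin d → Carrier) {A i j} → i ∈ A → j ∉ A →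
                  f i ≤ f j → weight ℝ f A ≤ weight ℝ f (swap A i j)
  weight-≤-swap f {A} {i} i∈A j∉A fi≤fj =
    +-cancelʳ-≤ (f i) (≤-respʳ-≈ (sym (weight-swap f i∈A j∉A)) (+-monoʳ-≤ (weight ℝ f A) fi≤fj))

  weight-swap-≤ : ∀ {d} (f : Fin d → Carrier) {A i j} → i ∈ A → j ∉ A →
                  weight ℝ f (swap A i j) ≤ weight ℝ f A → f j ≤ f i
  weight-swap-≤ f {A} {i} i∈A j∉A p =
    +-cancelˡ-≤ (weight ℝ f A) (≤-respˡ-≈ (weight-swap f i∈A j∉A) (+-monoˡ-≤ (f i) p))

  module _ (em : ExcludedMiddle 0ℓ) where
    argmax : ∀ {d} (f : Fin d → Carrier) (P : Pred (Fin d) 0ℓ) → ∃ P →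
             ∃[ e ] P e × (∀ {k} → P k → f k ≤ f e)
    argmax {zero}  f P (() , _)
    argmax {suc d} f P (k , Pk) with em {∃[ i ] P (suc i)} | em {P zero}
    ... | no none | no ¬P0 = ⊥-elim (absurd k Pk)
      where
      absurd : ∀ k → ¬ P k
      absurd zero    P0 = ¬P0 P0
      absurd (suc i) Pi = none (i , Pi)
    ... | no none | yes P0 = zero , P0 , λ
      { {zero} _ → ≤-refl ; {suc i} Pi → contradiction (i , Pi) none }
    ... | yes some | P0? with argmax (f ∘ suc) (P ∘ suc) some
    argmax {suc d} f P (k , Pk) | yes some | no ¬P0 | e , Pe , max = suc e , Pe , λ
      { {zero} P0 → contradiction P0 ¬P0 ; {suc i} Pi → max Pi }
    argmax {suc d} f P (k , Pk) | yes some | yes P0 | e , Pe , max with total (f zero) (f (suc e))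
    ... | inj₁ f0≤ = suc e , Pe , λ { {zero} _ → f0≤ ; {suc i} Pi → max Pi }
    ... | inj₂ ≤f0 = zero , P0 , λ { {zero} _ → ≤-refl ; {suc i} Pi → ≤-trans (max Pi) ≤f0 }

    module _ {d} (M : Matroid d) (f : Fin d → Carrier) {B} (bB : IsBasis M B)
             (localMax : ∀ {i j} → i ∈ B → j ∉ B → IsBasis M (swap B i j) → ¬ (f i ≤ f j))
             where

      module _ {C} (bC : IsBasis M C) where
        Differs : Fin d → Set
        Differs x = (x ∈ B × x ∉ C) ⊎ (x ∈ C × x ∉ B)

        max∉C─B : ∀ {e} → (∀ {k} → Differs k → f k ≤ f e) → e ∈ C → e ∈ B
        max∉C─B {e} max e∈C with e ∈? B
        ... | yes e∈B = e∈B
        ... | no e∉B with exchange-onto em M bB bC e∈C e∉B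
        ... | i , i∈B , i∉C , bS =
          contradiction (max (inj₁ (i∈B , i∉C))) (localMax i∈B e∉B bS)

        ¬Differs⇒≡ : ¬ ∃ Differs → C ≡ B
        ¬Differs⇒≡ none = ⊆-antisym
          (λ {x} x∈C → case x ∈? B of λ
            { (yes x∈B) → x∈B ; (no x∉B) → contradiction (x , inj₂ (x∈C , x∉B)) none })
          (λ {x} x∈B → case x ∈? C of λ
            { (yes x∈C) → x∈C ; (no x∉C) → contradiction (x , inj₁ (x∈B , x∉C)) none })

      globalMax : ∀ n {C} → IsBasis M C → ∣ B ─ C ∣ ℕ.≤ n →
                  C ≡ B ⊎ ¬ (weight ℝ f B ≤ weight ℝ f C)
      globalMax n {C} bC size with em {∃ (Differs bC)}
      ... | no none = inj₁ (¬Differs⇒≡ bC none)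
      ... | yes some with argmax f (Differs bC) some
      ... | e , inj₂ (e∈C , e∉B) , max = contradiction (max∉C─B bC max e∈C) e∉B
      ... | e , inj₁ (e∈B , e∉C) , max with exchange-onto em M bC bB e∈B e∉C
      ... | j , j∈C , j∉B , bS = inj₂ (step n size)
        where
        fe≰fj : ¬ (f e ≤ f j)
        fe≰fj fe≤fj = j∉B (max∉C─B bC (λ k → ≤-trans (max k) fe≤fj) j∈C)

        S≰C : ¬ (weight ℝ f (swap C j e) ≤ weight ℝ f C)
        S≰C p = fe≰fj (weight-swap-≤ f j∈C e∉C p)

        smaller : ∣ B ─ swap C j e ∣ ℕ.< ∣ B ─ C ∣
        smaller = ─-shrinks′ j∈C j∉B e∈B e∉C

        step : ∀ n → ∣ B ─ C ∣ ℕ.≤ n → ¬ (weight ℝ f B ≤ weight ℝ f C)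
        step zero    size = contradiction (ℕₚ.<-≤-trans smaller size) λ ()
        step (suc n) size B≤C with globalMax n bS (ℕₚ.≤-pred (ℕₚ.≤-trans smaller size))
        ... | inj₁ S≡B = S≰C (≤-respˡ-≈ (reflexive (≡.cong (weight ℝ f) (≡.sym S≡B))) B≤C)
        ... | inj₂ B≰S with total (weight ℝ f C) (weight ℝ f (swap C j e))
        ...   | inj₁ C≤S = B≰S (≤-trans B≤C C≤S)
        ...   | inj₂ S≤C = S≰C S≤C

    Generic-resp-order : ∀ {d} (M : Matroid d) (f g : Fin d → Carrier) →
                         (∀ i j → g i ≤ g j → f i ≤ f j) → Generic ℝ M f → Generic ℝ M g
    Generic-resp-order M f g g≤⇒f≤ (B , (bB , maxB) , unique) =
      B , (bB , λ bC → maximal bC (strict bC)) , λ {C} (bC , maxC) → uniqueness (strict bC) (maxC bB)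
      where
      localMax : ∀ {i j} → i ∈ B → j ∉ B → IsBasis M (swap B i j) → ¬ (g i ≤ g j)
      localMax {i} {j} i∈B j∉B bS gi≤gj = j∉B (≡.subst (j ∈_) (≡.sym B≡S) (∈swap-new {A = B} {i} j))
        where
        B≡S : B ≡ swap B i j
        B≡S = unique (bS , λ bC → ≤-trans (maxB bC) (weight-≤-swap f i∈B j∉B (g≤⇒f≤ i j gi≤gj)))

      strict : ∀ {C} → IsBasis M C → C ≡ B ⊎ ¬ (weight ℝ g B ≤ weight ℝ g C)
      strict bC = globalMax M g bB localMax _ bC ℕₚ.≤-refl

      maximal : ∀ {C} → IsBasis M C → C ≡ B ⊎ ¬ (weight ℝ g B ≤ weight ℝ g C) →
                weight ℝ g C ≤ weight ℝ g B
      maximal bC (inj₁ refl) = ≤-refl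
      maximal {C} bC (inj₂ B≰C) with total (weight ℝ g C) (weight ℝ g B)
      ... | inj₁ C≤B = C≤B
      ... | inj₂ B≤C = contradiction B≤C B≰C

      uniqueness : ∀ {C} → C ≡ B ⊎ ¬ (weight ℝ g B ≤ weight ℝ g C) →
                   weight ℝ g B ≤ weight ℝ g C → B ≡ C
      uniqueness (inj₁ C≡B) _   = ≡.sym C≡B
      uniqueness (inj₂ B≰C) B≤C = contradiction B≤C B≰C

    Generic-resp-setComposition : ∀ {d} (M : Matroid d) (f g : Fin d → ℕ⁺) →
      setComposition f ≡ setComposition g →
      Generic ℝ M (fromℕ ℝ ∘ value ∘ f) → Generic ℝ M (fromℕ ℝ ∘ value ∘ g)
    Generic-resp-setComposition M f g eq = Generic-resp-order M _ _ λ i j p →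
      fromℕ-mono-≤ (setComposition-≤ f g eq i j (fromℕ-cancel-≤ _ _ p))

    Generic-resp-bases : ∀ {d} (M N : Matroid d) → Setoid._≈_ (matroidSetoid d) M N →
                         ∀ {f} → Generic ℝ M f → Generic ℝ N f
    Generic-resp-bases M N M≈N (B , (bB , maxB) , unique) =
      B , (to B bB , λ {C} bC → maxB {C} (from C bC)) ,
      λ {C} (bC , maxC) → unique (from C bC , λ {D} bD → maxC {D} (to D bD))
      where
      to : ∀ B → IsBasis M B → IsBasis N B
      to B = ≡.subst T (M≈N B)
      from : ∀ B → IsBasis N B → IsBasis M B
      from B = ≡.subst T (≡.sym (M≈N B))

-- Constructively, membership in a polytope and genericity are not
-- decidable over an abstract ordered field.  Excluded middle makes the
-- 0/1-valued indicator functions and coefficients definable.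

module _ (em : ExcludedMiddle 0ℓ) (ℝ : CompleteOrderedField) where
  private module ℝ = CompleteOrderedField ℝ

  Mat : LeftModule ℝ.ring 0ℓ 0ℓ
  Mat = ⨁ λ d → freeModule ℝ.ring (matroidSetoid d)

  Series : ℕ → Set
  Series d = (Fin d → ℕ⁺) → ℝ.Carrier

  record WordQuasisymmetric (d : ℕ) : Set where
    field
      coefficient : Series d
      invariant   : ∀ f g → setComposition f ≡ setComposition g →
                    coefficient f ℝ.≈ coefficient g
  open WordQuasisymmetric

  WQSym[_] : ℕ → LeftModule ℝ.ring 0ℓ 0ℓ
  WQSym[ d ] = record
    { Carrierᴹ = WordQuasisymmetric d
    ; _≈ᴹ_     = λ x y → ∀ f → coefficient x f ℝ.≈ coefficient y f
    ; _+ᴹ_     = λ x y → record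
      { coefficient = λ f → coefficient x f ℝ.+ coefficient y f
      ; invariant   = λ f g eq → ℝ.+-cong (invariant x f g eq) (invariant y f g eq)
      }
    ; _*ₗ_     = λ k x → record
      { coefficient = λ f → k ℝ.* coefficient x f
      ; invariant   = λ f g eq → ℝ.*-congˡ (invariant x f g eq)
      }
    ; 0ᴹ       = record { coefficient = λ _ → ℝ.0# ; invariant = λ _ _ _ → ℝ.refl }
    ; -ᴹ_      = λ x → record
      { coefficient = λ f → ℝ.- coefficient x f
      ; invariant   = λ f g eq → ℝ.-‿cong (invariant x f g eq)
      }
    ; isLeftModule = record
      { isLeftSemimodule = record
        { +ᴹ-isCommutativeMonoid = record
          { isMonoid = record
            { isSemigroup = record
              { isMagma = record
                { isEquivalence = record
                  { refl  = λ _ → ℝ.refl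
                  ; sym   = λ p f → ℝ.sym (p f)
                  ; trans = λ p q f → ℝ.trans (p f) (q f)
                  }
                ; ∙-cong = λ p q f → ℝ.+-cong (p f) (q f)
                }
              ; assoc = λ _ _ _ _ → ℝ.+-assoc _ _ _
              }
            ; identity = (λ _ _ → ℝ.+-identityˡ _) , (λ _ _ → ℝ.+-identityʳ _)
            }
          ; comm = λ _ _ _ → ℝ.+-comm _ _
          }
        ; isPreleftSemimodule = record
          { *ₗ-cong      = λ p q f → ℝ.*-cong p (q f)
          ; *ₗ-zeroˡ     = λ _ _ → ℝ.zeroˡ _
          ; *ₗ-distribʳ  = λ _ _ _ _ → ℝ.distribʳ _ _ _
          ; *ₗ-identityˡ = λ _ _ → ℝ.*-identityˡ _
          ; *ₗ-assoc     = λ _ _ _ _ → ℝ.*-assoc _ _ _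
          ; *ₗ-zeroʳ     = λ _ _ → ℝ.zeroʳ _
          ; *ₗ-distribˡ  = λ _ _ _ _ → ℝ.distribˡ _ _ _
          }
        }
      ; -ᴹ‿cong    = λ p f → ℝ.-‿cong (p f)
      ; -ᴹ‿inverse = (λ _ _ → ℝ.-‿inverseˡ _) , (λ _ _ → ℝ.-‿inverseʳ _)
      }
    }

  WQSym : LeftModule ℝ.ring 0ℓ 0ℓ
  WQSym = ⨁ WQSym[_]

  decide : Set → ℝ.Carrier
  decide P = if does (em {P}) then ℝ.1# else ℝ.0#

  decide-cong : ∀ {P Q} → (P → Q) → (Q → P) → decide P ℝ.≈ decide Q
  decide-cong {P} {Q} to from with em {P} | em {Q}
  ... | yes p | yes q = ℝ.refl
  ... | yes p | no ¬q = contradiction (to p) ¬q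
  ... | no ¬p | yes q = contradiction (from q) ¬p
  ... | no ¬p | no ¬q = ℝ.refl

  Ψ[_] : ∀ {d} → Matroid d → WordQuasisymmetric d
  Ψ[ M ] = record
    { coefficient = λ f → decide (Generic ℝ M (fromℕ ℝ ∘ value ∘ f))
    ; invariant   = λ f g eq → decide-cong
        (Generic-resp-setComposition ℝ em M f g eq)
        (Generic-resp-setComposition ℝ em M g f (≡.sym eq))
    }

  Ψ : LinearMap Mat WQSym
  Ψ = ⨁-map λ d → extend ℝ.ring (matroidSetoid d) WQSym[ d ] Ψ[_] λ {M} {N} M≈N f → decide-cong
    (Generic-resp-bases ℝ em M N M≈N)
    (Generic-resp-bases ℝ em N M (λ B → ≡.sym (M≈N B)))

  𝟙 : ∀ {d} → Pred (ℝ^ ℝ d) 0ℓ → ℝ^ ℝ d → ℤ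
  𝟙 P x = if does (em {P x}) then + 1 else + 0

  -- Functions ℝ^d → ℤ are not asked to respect _≈_ on ℝ^d: those in the
  -- generated subgroup do so automatically.

  IsPolytopeIndicator : ∀ d → Pred (ℝ^ ℝ d → ℤ) 0ℓ
  IsPolytopeIndicator d h = ∃[ M ] (∀ x → h x ≡ 𝟙 (BasePolytope ℝ {d} M) x)

  PS[_] : ℕ → AbelianGroup 0ℓ 0ℓ
  PS[ d ] = generatedSubgroup (Pointwise.abelianGroup (ℝ^ ℝ d) ℤₚ.+-0-abelianGroup)
                              (IsPolytopeIndicator d)

  PS : AbelianGroup 0ℓ 0ℓ
  PS = ⨁ᴳ PS[_]

  𝟙[P_] : ∀ {d} → Matroid d → AbelianGroup.Carrier PS[ d ]
  𝟙[P M ] = 𝟙 (BasePolytope ℝ M) , generator (M , λ _ → refl)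

  matroid : ∀ {d} → Matroid d → LeftModule.Carrierᴹ Mat
  matroid {d} M = ι (λ e → underlying (freeModule ℝ.ring (matroidSetoid e))) d [ M ]

  polytope : ∀ {d} → Matroid d → AbelianGroup.Carrier PS
  polytope {d} M = ι PS[_] d 𝟙[P M ]

  module _ (A : AbelianGroup c ℓ) where
    open GroupMorphisms (AbelianGroup.rawGroup PS) (AbelianGroup.rawGroup A)

    StronglyValuative : (LeftModule.Carrierᴹ Mat → AbelianGroup.Carrier A) → Set (c ⊔ ℓ)
    StronglyValuative Φ =
      Σ[ Φ̂ ∈ (AbelianGroup.Carrier PS → AbelianGroup.Carrier A) ]
        IsGroupHomomorphism Φ̂ ×
        (∀ d (M : Matroid d) → AbelianGroup._≈_ A (Φ (matroid M)) (Φ̂ (polytope M)))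

{-# OPTIONS --safe #-}
module Submission where

-- The task is to show that a relation ∑ aᵢ 𝟙[P Mᵢ] = 0 forces ∑ aᵢ [f is Mᵢ-generic] = 0.
--
-- The Euler characteristic takes care of non-emptiness: for polytopes in ℝⁿ, ∑ aᵢ 𝟙[Kᵢ] = 0
-- implies ∑ aᵢ [Kᵢ ≠ ∅] = 0.  By induction on n this holds for the slices at x₁ = t, for every t.
-- The x₁-coordinates of the points of K form a closed interval, so that for ε small
--   [max x₁ = c on K] = [K meets x₁ = c] − [K meets x₁ = c + ε].
-- Hence the aᵢ with max x₁ = c on Kᵢ sum to 0 for every c, and one sums over c.
-- Slices are again polytopes because a section of a finitely generated cone by a hyperplane is
-- generated by the generators on the hyperplane and by one combination for each pair of
-- generators on opposite sides.
--
-- For B ⊆ [d] let g = (d + 1) f + 𝟙[complement of B].  Since f is positive and integral,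
-- g (C) = g (B) only for C = B, and the maximum of g over P M is g (B) if and only if B is the
-- unique f-maximal basis of M.  Adjoining g as a first coordinate to P M, the statement on
-- maxima of x₁ gives ∑ aᵢ [B is the unique f-maximal basis of Mᵢ] = 0; now sum over B.

open import Level using (0ℓ)
open import Axiom.ExcludedMiddle using (ExcludedMiddle)
open import Algebra.Bundles using (AbelianGroup; CommutativeMonoid)
import Algebra.Construct.Pointwise as Pointwise
open import Algebra.Module.Bundles using (LeftModule)
import Algebra.Module.Construct.DirectProduct as DirectProduct
import Algebra.Module.Construct.TensorUnit as TensorUnit
import Algebra.Properties.CommutativeMonoid.Sum as SumProperties
import Algebra.Properties.CommutativeSemigroup as CommutativeSemigroupProperties
import Algebra.Properties.Monoid.Mult as Mult
import Algebra.Properties.Ring as RingProperties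
open import Data.Bool.Base using (if_then_else_)
open import Data.Bool.Properties using (T?)
open import Data.Fin.Base using (Fin; zero; suc)
open import Data.Fin.Subset using (Subset; inside; outside)
open import Data.Integer.Base as ℤ using (ℤ; +_; -[1+_]; 0ℤ; 1ℤ)
import Data.Integer.Properties as ℤₚ
open import Data.Irrelevant using ([_])
open import Data.List.Base using (List; []; _∷_; _++_; map; filter; cartesianProduct)
open import Data.List.Membership.Propositional using (_∈_)
open import Data.List.Membership.Propositional.Properties
  using (∈-map⁺; ∈-map⁻; ∈-++⁺ˡ; ∈-++⁺ʳ; ∈-++⁻; ∈-filter⁺; ∈-filter⁻;
         ∈-cartesianProduct⁺; ∈-cartesianProduct⁻)
open import Data.List.Relation.Unary.Any using (Any; here; there)
open import Data.Nat.Base as ℕ using (ℕ; zero; suc; z≤n; s≤s)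
import Data.Nat.Properties as ℕₚ
open import Data.Product.Base using (∃-syntax; _×_; _,_; proj₁; proj₂; map₁; map₂; uncurry)
open import Data.Refinement using (value; _,_)
open import Data.Sum.Base using (_⊎_; inj₁; inj₂; [_,_]′)
open import Data.Vec.Base using ([]; _∷_; lookup)
import Data.Vec.Functional as Vector
open import Function.Base using (_∘_; id)
open import Relation.Binary.Core using (Rel)
open import Relation.Binary.PropositionalEquality as ≡ using (_≡_; cong; cong₂; module ≡-Reasoning)
import Relation.Binary.Reasoning.Setoid as ≈-Reasoning
open import Relation.Binary.Structures using (IsTotalOrder)
open import Relation.Nullary using (¬_; yes; no; does; contradiction)
open import Relation.Unary using (Pred; _∪_; _⊆_)
open import Defs

open Matroid using (IsBasis; basis?)

-- Signed counts

module _ (em : ExcludedMiddle 0ℓ) where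

  restrict : ℤ → Set → ℤ
  restrict a A = if does (em {A}) then a else 0ℤ

module _ (em : ExcludedMiddle 0ℓ) {X : Set} where

  -- A list keeps repeated entries apart, so formal combinations can be added and negated without
  -- deciding equality of matroids or polytopes.
  ∑ : List (ℤ × X) → Pred X 0ℓ → ℤ
  ∑ []            P = 0ℤ
  ∑ ((a , x) ∷ L) P = restrict em a (P x) ℤ.+ ∑ L P

  -- The equivalence is asked only at members of the list: in `∑-Top` the level t is chosen in terms
  -- of the list and is guaranteed to work only for its members.
  ∑-cong-∈ : ∀ {P Q} L → (∀ {x} → x ∈ map proj₂ L → (P x → Q x) × (Q x → P x)) → ∑ L P ≡ ∑ L Q
  ∑-cong-∈ []            eq = ≡.refl
  ∑-cong-∈ {P} {Q} ((a , x) ∷ L) eq = cong₂ ℤ._+_ head (∑-cong-∈ L (eq ∘ there))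
    where
    head : restrict em a (P x) ≡ restrict em a (Q x)
    head with em {P x} | em {Q x}
    ... | yes p | yes q = ≡.refl
    ... | yes p | no ¬q = contradiction (proj₁ (eq (here ≡.refl)) p) ¬q
    ... | no ¬p | yes q = contradiction (proj₂ (eq (here ≡.refl)) q) ¬p
    ... | no ¬p | no ¬q = ≡.refl

  ∑-cong : ∀ {P Q} L → P ⊆ Q → Q ⊆ P → ∑ L P ≡ ∑ L Q
  ∑-cong L to from = ∑-cong-∈ L λ _ → to , from

  ∑-empty : ∀ {P} L → (∀ {x} → ¬ P x) → ∑ L P ≡ 0ℤ
  ∑-empty []                    ¬P = ≡.refl
  ∑-empty {P} ((a , x) ∷ L) ¬P with em {P x}
  ... | yes p = contradiction p ¬P
  ... | no _  = ≡.trans (ℤₚ.+-identityˡ _) (∑-empty L ¬P)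

  ∑-∪ : ∀ {P Q} L → (∀ {x} → P x → ¬ Q x) → ∑ L (P ∪ Q) ≡ ∑ L P ℤ.+ ∑ L Q
  ∑-∪ []            disjoint = ≡.refl
  ∑-∪ {P} {Q} ((a , x) ∷ L) disjoint =
    ≡.trans (cong₂ ℤ._+_ head (∑-∪ L disjoint))
            (interchange (restrict em a (P x)) (restrict em a (Q x)) (∑ L P) (∑ L Q))
    where
    open CommutativeSemigroupProperties ℤₚ.+-commutativeSemigroup using (interchange)
    head : restrict em a (P x ⊎ Q x) ≡
           restrict em a (P x) ℤ.+ restrict em a (Q x)
    head with em {P x ⊎ Q x} | em {P x} | em {Q x}
    ... | _           | yes p | yes q = contradiction q (disjoint p)
    ... | yes _       | yes p | no ¬q = ≡.sym (ℤₚ.+-identityʳ a)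
    ... | yes _       | no ¬p | yes q = ≡.sym (ℤₚ.+-identityˡ a)
    ... | yes p⊎q     | no ¬p | no ¬q = contradiction p⊎q [ ¬p , ¬q ]′
    ... | no ¬p⊎q     | yes p | no ¬q = contradiction (inj₁ p) ¬p⊎q
    ... | no ¬p⊎q     | no ¬p | yes q = contradiction (inj₂ q) ¬p⊎q
    ... | no _        | no _  | no _  = ≡.refl

  ∑-++ : ∀ {P} K L → ∑ (K ++ L) P ≡ ∑ K P ℤ.+ ∑ L P
  ∑-++ []            L = ≡.sym (ℤₚ.+-identityˡ _)
  ∑-++ {P} ((a , x) ∷ K) L = ≡.trans
    (cong (ℤ._+_ (restrict em a (P x))) (∑-++ K L))
    (≡.sym (ℤₚ.+-assoc (restrict em a (P x)) (∑ K P) (∑ L P)))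

  ∑-neg : ∀ {P} L → ∑ (map (map₁ λ a → ℤ.- a) L) P ≡ ℤ.- ∑ L P
  ∑-neg []            = ≡.refl
  ∑-neg {P} ((a , x) ∷ L) =
    ≡.trans (cong₂ ℤ._+_ head (∑-neg L)) (≡.sym (ℤₚ.neg-distrib-+ (restrict em a (P x)) (∑ L P)))
    where
    head : restrict em (ℤ.- a) (P x) ≡ ℤ.- restrict em a (P x)
    head with em {P x}
    ... | yes _ = ≡.refl
    ... | no _  = ≡.refl

  module _ {C : Set} (P : C → Pred X 0ℓ)
           (exclusive : ∀ {c c′ x} → P c x → P c′ x → P c ⊆ P c′) where

    private
      ∑-fibres : ∀ L → (∀ c → ∑ L (P c) ≡ 0ℤ) → ∀ cs → ∑ L (λ x → Any (λ c → P c x) cs) ≡ 0ℤ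
      ∑-fibres L vanish []       = ∑-empty L λ ()
      ∑-fibres L vanish (c ∷ cs) with em {Any (λ c′ → P c ⊆ P c′) cs}
      ... | yes c∈cs = ≡.trans
        (∑-cong L (λ { (here p) → transport c∈cs p ; (there p) → p }) there)
        (∑-fibres L vanish cs)
        where
        transport : ∀ {cs x} → Any (λ c′ → P c ⊆ P c′) cs → P c x → Any (λ c → P c x) cs
        transport (here ⊆) p = here (⊆ p)
        transport (there r) p = there (transport r p)
      ... | no c∉cs = begin
        ∑ L (λ x → Any (λ c → P c x) (c ∷ cs))
          ≡⟨ ∑-cong L (λ { (here p) → inj₁ p ; (there p) → inj₂ p }) [ here , there ]′ ⟩
        ∑ L (P c ∪ (λ x → Any (λ c → P c x) cs))
          ≡⟨ ∑-∪ L (λ p q → c∉cs (transport p q)) ⟩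
        ∑ L (P c) ℤ.+ ∑ L (λ x → Any (λ c → P c x) cs)
          ≡⟨ cong₂ ℤ._+_ (vanish c) (∑-fibres L vanish cs) ⟩
        0ℤ ∎
        where
        open ≡-Reasoning
        transport : ∀ {cs x} → P c x → Any (λ c′ → P c′ x) cs → Any (λ c′ → P c ⊆ P c′) cs
        transport p (here q)  = here (exclusive p q)
        transport p (there r) = there (transport p r)

      -- `C` may be infinite, but one index for each listed element that has any is enough.
      occurring : ∀ xs → ∃[ cs ] (∀ {x c} → x ∈ xs → P c x → Any (λ c → P c x) cs)
      occurring []       = [] , λ ()
      occurring (y ∷ xs) with em {∃[ c ] P c y} | occurring xs
      ... | yes (c , p) | cs , covers = c ∷ cs , λ
        { (here ≡.refl) _ → here p ; (there x∈) q → there (covers x∈ q) }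
      ... | no none     | cs , covers = cs , λ
        { (here ≡.refl) p → contradiction (_ , p) none ; (there x∈) q → covers x∈ q }

    ∑-∃ : ∀ L → (∀ c → ∑ L (P c) ≡ 0ℤ) → ∑ L (λ x → ∃[ c ] P c x) ≡ 0ℤ
    ∑-∃ L vanish with occurring (map proj₂ L)
    ... | cs , covers = ≡.trans
      (∑-cong-∈ L λ x∈ → (λ (c , p) → covers x∈ p) , witness)
      (∑-fibres L vanish cs)
      where
      witness : ∀ {cs x} → Any (λ c → P c x) cs → ∃[ c ] P c x
      witness (here p)  = _ , p
      witness (there p) = witness p

∑-map : ∀ (em : ExcludedMiddle 0ℓ) {X Y : Set} (f : X → Y) {P} L →
        ∑ em (map (map₂ f) L) P ≡ ∑ em L (P ∘ f)
∑-map em f         []            = ≡.refl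
∑-map em f {P} ((a , x) ∷ L) =
  cong (λ n → restrict em a (P (f x)) ℤ.+ n) (∑-map em f L)

-- Ordered fields and cones

module OrderedField (ℝ : CompleteOrderedField) where
  open CompleteOrderedField ℝ public hiding (_-_; zero)
  open IsTotalOrder isTotalOrder public
    using (total; antisym; ≤-respʳ-≈; ≤-respˡ-≈)
    renaming (refl to ≤-refl; trans to ≤-trans; reflexive to ≤-reflexive)
  open RingProperties ring public using (-‿distribˡ-*; -‿distribʳ-*; -‿involutive; -0#≈0#; -‿+-comm)

  infix 4 _<_
  -- For a total order this is the strict order, and the negative branch of `em {y ≤ x}` is then
  -- literally a strict inequality.
  _<_ : Rel Carrier 0ℓ
  x < y = ¬ (y ≤ x)

  <⇒≤ : ∀ {x y} → x < y → x ≤ y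
  <⇒≤ {x} {y} x<y with total x y
  ... | inj₁ x≤y = x≤y
  ... | inj₂ y≤x = contradiction y≤x x<y

  <-≤-trans : ∀ {x y z} → x < y → y ≤ z → x < z
  <-≤-trans x<y y≤z z≤x = x<y (≤-trans y≤z z≤x)

  ≤-<-trans : ∀ {x y z} → x ≤ y → y < z → x < z
  ≤-<-trans x≤y y<z z≤x = y<z (≤-trans z≤x x≤y)

  <⇒≉ : ∀ {x y} → x < y → ¬ (y ≈ x)
  <⇒≉ x<y y≈x = x<y (≤-reflexive y≈x)

  neg-≤ : ∀ {x y} → x ≤ y → - y ≤ - x
  neg-≤ {x} {y} x≤y =
    ≤-respˡ-≈ (cancel x y) (≤-respʳ-≈ (trans (+-congʳ (+-comm _ _)) (cancel y x))
      (+-monoʳ-≤ (- x + - y) x≤y))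
    where
    cancel : ∀ x y → (- x + - y) + x ≈ - y
    cancel x y = trans (+-congʳ (+-comm _ _)) (trans (+-assoc _ _ _)
      (trans (+-congˡ (-‿inverseˡ x)) (+-identityʳ _)))

  +-pos : ∀ {x y} → 0# < x → 0# ≤ y → 0# < x + y
  +-pos {x} 0<x 0≤y = <-≤-trans 0<x (≤-respˡ-≈ (+-identityʳ x) (+-monoʳ-≤ x 0≤y))

  x<x+y : ∀ x {y} → 0# < y → x < x + y
  x<x+y x 0<y x+y≤x = 0<y (+-cancelˡ-≤ ℝ x (≤-respʳ-≈ (sym (+-identityʳ x)) x+y≤x))

  -- A product of nonnegative factors that is at most 0 equals 0, and multiplying by the inverse of
  -- x would give y ≈ 0.
  *-pos : ∀ {x y} → 0# < x → 0# < y → 0# < x * y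
  *-pos {x} {y} 0<x 0<y xy≤0 with invertible (<⇒≉ 0<x)
  ... | x⁻¹ , inverseˡ , _ = <⇒≉ 0<y (begin
    y              ≈⟨ *-identityˡ y ⟨
    1# * y         ≈⟨ *-congʳ inverseˡ ⟨
    x⁻¹ * x * y    ≈⟨ *-assoc _ _ _ ⟩
    x⁻¹ * (x * y)  ≈⟨ *-congˡ (antisym xy≤0 (*-nonneg (<⇒≤ 0<x) (<⇒≤ 0<y))) ⟩
    x⁻¹ * 0#       ≈⟨ zeroʳ _ ⟩
    0#             ∎)
    where open ≈-Reasoning setoid

  0<1 : 0# < 1#
  0<1 1≤0 = 0≉1 (antisym (0≤1 ℝ) 1≤0)

  neg-pos : ∀ {x} → x < 0# → 0# < - x
  neg-pos {x} x<0 -x≤0 =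
    x<0 (≤-respˡ-≈ -0#≈0# (≤-respʳ-≈ (-‿involutive x) (neg-≤ -x≤0)))

  reciprocal : ∀ {x} → 0# < x → ∃[ y ] 0# < y × y * x ≈ 1#
  reciprocal {x} 0<x with invertible (<⇒≉ 0<x)
  ... | y , inverseˡ , _ = y , 0<y , inverseˡ
    where
    0<y : 0# < y
    -- If y ≤ 0, then - y and x are both nonnegative, and so is their product - 1.
    0<y y≤0 = 0<1 (≤-respʳ-≈ -0#≈0# (≤-respˡ-≈ (-‿involutive 1#) (neg-≤ 0≤-1)))
      where
      0≤-1 : 0# ≤ - 1#
      0≤-1 = ≤-respʳ-≈ (trans (sym (-‿distribˡ-* y x)) (-‿cong inverseˡ))
               (*-nonneg (≤-respˡ-≈ -0#≈0# (neg-≤ y≤0)) (<⇒≤ 0<x))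

module Cones (em : ExcludedMiddle 0ℓ) (ℝ : CompleteOrderedField)
             (V : LeftModule (CompleteOrderedField.ring ℝ) 0ℓ 0ℓ) where
  open OrderedField ℝ
  open LeftModule V
  open CommutativeSemigroupProperties
    (CommutativeMonoid.commutativeSemigroup +ᴹ-commutativeMonoid)
    using (interchange; x∙yz≈y∙xz)

  -- The equations inside the constructors leave the index a variable, so that inductions never have
  -- to unify a vector with a sum.
  data Cone (S : Pred Carrierᴹ 0ℓ) : Pred Carrierᴹ 0ℓ where
    apex : ∀ {v} → v ≈ᴹ 0ᴹ → Cone S v
    ray  : ∀ {k p u v} → 0# ≤ k → S p → Cone S u → v ≈ᴹ k *ₗ p +ᴹ u → Cone S v

  module _ {S : Pred Carrierᴹ 0ℓ} where

    cone-resp-≈ : ∀ {u v} → u ≈ᴹ v → Cone S u → Cone S v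
    cone-resp-≈ u≈v (apex u≈0)       = apex (≈ᴹ-trans (≈ᴹ-sym u≈v) u≈0)
    cone-resp-≈ u≈v (ray 0≤k Sp c e) = ray 0≤k Sp c (≈ᴹ-trans (≈ᴹ-sym u≈v) e)

    cone-+ : ∀ {u v} → Cone S u → Cone S v → Cone S (u +ᴹ v)
    cone-+ (apex u≈0)       d = cone-resp-≈ (≈ᴹ-sym (≈ᴹ-trans (+ᴹ-congʳ u≈0) (+ᴹ-identityˡ _))) d
    cone-+ (ray 0≤k Sp c e) d = ray 0≤k Sp (cone-+ c d) (≈ᴹ-trans (+ᴹ-congʳ e) (+ᴹ-assoc _ _ _))

    cone-* : ∀ {k v} → 0# ≤ k → Cone S v → Cone S (k *ₗ v)
    cone-* {k} 0≤k (apex v≈0)       = apex (≈ᴹ-trans (*ₗ-congˡ v≈0) (*ₗ-zeroʳ k))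
    cone-* {k} 0≤k (ray 0≤l Sp c e) = ray (*-nonneg 0≤k 0≤l) Sp (cone-* 0≤k c)
      (≈ᴹ-trans (*ₗ-congˡ e) (≈ᴹ-trans (*ₗ-distribˡ k _ _) (+ᴹ-congʳ (≈ᴹ-sym (*ₗ-assoc k _ _)))))

    cone-gen : S ⊆ Cone S
    cone-gen {p} Sp = ray (0≤1 ℝ) Sp (apex ≈ᴹ-refl)
      (≈ᴹ-sym (≈ᴹ-trans (+ᴹ-identityʳ _) (*ₗ-identityˡ p)))

  cone-bind : ∀ {S T} → S ⊆ Cone T → Cone S ⊆ Cone T
  cone-bind S⊆T (apex v≈0)       = apex v≈0
  cone-bind S⊆T (ray 0≤k Sp c e) =
    cone-resp-≈ (≈ᴹ-sym e) (cone-+ (cone-* 0≤k (S⊆T Sp)) (cone-bind S⊆T c))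

  -- `⟦⟧-ray` expresses linearity in the shape in which `ray` presents a point of a cone.
  record Functional : Set where
    field
      ⟦_⟧      : Carrierᴹ → Carrier
      ⟦⟧-cong  : ∀ {u v} → u ≈ᴹ v → ⟦ u ⟧ ≈ ⟦ v ⟧
      ⟦⟧-zero  : ⟦ 0ᴹ ⟧ ≈ 0#
      ⟦⟧-ray   : ∀ k p u → ⟦ k *ₗ p +ᴹ u ⟧ ≈ k * ⟦ p ⟧ + ⟦ u ⟧

    ⟦⟧-+ : ∀ u v → ⟦ u +ᴹ v ⟧ ≈ ⟦ u ⟧ + ⟦ v ⟧
    ⟦⟧-+ u v = trans (⟦⟧-cong (+ᴹ-congʳ (≈ᴹ-sym (*ₗ-identityˡ u))))
      (trans (⟦⟧-ray 1# u v) (+-congʳ (*-identityˡ _)))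

    ⟦⟧-ray-≈ : ∀ {k p u v} → v ≈ᴹ k *ₗ p +ᴹ u → ⟦ v ⟧ ≈ k * ⟦ p ⟧ + ⟦ u ⟧
    ⟦⟧-ray-≈ e = trans (⟦⟧-cong e) (⟦⟧-ray _ _ _)

    cone-zero : ∀ {S} → (∀ {p} → S p → ⟦ p ⟧ ≈ 0#) → ∀ {u} → Cone S u → ⟦ u ⟧ ≈ 0#
    cone-zero vanish (apex u≈0)     = trans (⟦⟧-cong u≈0) ⟦⟧-zero
    cone-zero vanish (ray _ Sp c e) = trans (⟦⟧-ray-≈ e)
      (trans (+-cong (trans (*-congˡ (vanish Sp)) (zeroʳ _)) (cone-zero vanish c)) (+-identityˡ _))

    -- A ray with coefficient 0 changes nothing and one with positive coefficient raises the value.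
    -- Hence such a cone meets the hyperplane ⟦ u ⟧ = 0 in its apex alone.
    cone-positive : ∀ {S} → (∀ {p} → S p → 0# < ⟦ p ⟧) → ∀ {u} → Cone S u → u ≈ᴹ 0ᴹ ⊎ 0# < ⟦ u ⟧
    cone-positive pos (apex u≈0) = inj₁ u≈0
    cone-positive pos (ray {k} {p} 0≤k Sp c e) with em {k ≤ 0#} | cone-positive pos c
    ... | yes k≤0 | inj₁ u≈0 = inj₁ (≈ᴹ-trans e (≈ᴹ-trans
      (+ᴹ-cong (≈ᴹ-trans (*ₗ-congʳ (antisym k≤0 0≤k)) (*ₗ-zeroˡ p)) u≈0) (+ᴹ-identityˡ _)))
    ... | no 0<k  | inj₁ u≈0 = inj₂ λ v≤0 → *-pos 0<k (pos Sp) (≤-respˡ-≈ (trans (⟦⟧-ray-≈ e)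
      (trans (+-congˡ (trans (⟦⟧-cong u≈0) ⟦⟧-zero)) (+-identityʳ _))) v≤0)
    ... | _       | inj₂ 0<u = inj₂ λ v≤0 → +-pos 0<u (*-nonneg 0≤k (<⇒≤ (pos Sp)))
      (≤-respˡ-≈ (trans (⟦⟧-ray-≈ e) (+-comm _ _)) v≤0)

  negate : Functional → Functional
  negate a = record
    { ⟦_⟧     = λ v → - ⟦ v ⟧
    ; ⟦⟧-cong = λ e → -‿cong (⟦⟧-cong e)
    ; ⟦⟧-zero = trans (-‿cong ⟦⟧-zero) -0#≈0#
    ; ⟦⟧-ray  = λ k p u → trans (-‿cong (⟦⟧-ray k p u))
        (trans (sym (-‿+-comm _ _)) (+-congʳ (-‿distribʳ-* _ _)))
    }
    where open Functional a

  -- Sections of a cone by a hyperplane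

  module Slice (a : Functional) where
    open Functional a

    -- If ⟦ u ⟧ > 0 > ⟦ v ⟧, this is a positive multiple of the point where the segment from u to v
    -- crosses the hyperplane. Clearing the denominator makes it linear in each argument.
    combine : Carrierᴹ → Carrierᴹ → Carrierᴹ
    combine u v = (- ⟦ v ⟧) *ₗ u +ᴹ ⟦ u ⟧ *ₗ v

    private
      distribute : ∀ {k l l₁ l₂} v → l ≈ k * l₁ + l₂ → l *ₗ v ≈ᴹ k *ₗ (l₁ *ₗ v) +ᴹ l₂ *ₗ v
      distribute {k} {l} {l₁} {l₂} v e = ≈ᴹ-trans (*ₗ-congʳ e)
        (≈ᴹ-trans (*ₗ-distribʳ v (k * l₁) l₂) (+ᴹ-congʳ (*ₗ-assoc k l₁ v)))

      distribute′ : ∀ {k l p u v} → v ≈ᴹ k *ₗ p +ᴹ u → l *ₗ v ≈ᴹ k *ₗ (l *ₗ p) +ᴹ l *ₗ u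
      distribute′ {k} {l} {p} {u} {v} e = ≈ᴹ-trans (*ₗ-congˡ e)
        (≈ᴹ-trans (*ₗ-distribˡ l _ _) (+ᴹ-congʳ
          (≈ᴹ-trans (≈ᴹ-sym (*ₗ-assoc l k p)) (≈ᴹ-trans (*ₗ-congʳ (*-comm l k)) (*ₗ-assoc k l p)))))

      gather : ∀ {k x y x₁ x₂ y₁ y₂} → x ≈ᴹ k *ₗ x₁ +ᴹ x₂ → y ≈ᴹ k *ₗ y₁ +ᴹ y₂ →
               x +ᴹ y ≈ᴹ k *ₗ (x₁ +ᴹ y₁) +ᴹ (x₂ +ᴹ y₂)
      gather e f = ≈ᴹ-trans (+ᴹ-cong e f)
        (≈ᴹ-trans (interchange _ _ _ _) (+ᴹ-congʳ (≈ᴹ-sym (*ₗ-distribˡ _ _ _))))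

    combine-rayˡ : ∀ {k p u u′} v → u ≈ᴹ k *ₗ p +ᴹ u′ →
                   combine u v ≈ᴹ k *ₗ combine p v +ᴹ combine u′ v
    combine-rayˡ v e = gather (distribute′ e) (distribute v (⟦⟧-ray-≈ e))

    combine-rayʳ : ∀ {k q v v′} u → v ≈ᴹ k *ₗ q +ᴹ v′ →
                   combine u v ≈ᴹ k *ₗ combine u q +ᴹ combine u v′
    combine-rayʳ u e = gather
      (distribute u (Functional.⟦⟧-ray-≈ (negate a) e))
      (distribute′ e)

    combine-zeroˡ : ∀ {u} v → u ≈ᴹ 0ᴹ → combine u v ≈ᴹ 0ᴹ
    combine-zeroˡ v u≈0 = ≈ᴹ-trans
      (+ᴹ-cong (≈ᴹ-trans (*ₗ-congˡ u≈0) (*ₗ-zeroʳ _))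
               (≈ᴹ-trans (*ₗ-congʳ (trans (⟦⟧-cong u≈0) ⟦⟧-zero)) (*ₗ-zeroˡ v)))
      (+ᴹ-identityˡ _)

    combine-zeroʳ : ∀ {v} u → v ≈ᴹ 0ᴹ → combine u v ≈ᴹ 0ᴹ
    combine-zeroʳ u v≈0 = ≈ᴹ-trans
      (+ᴹ-cong (≈ᴹ-trans (*ₗ-congʳ (trans (-‿cong (trans (⟦⟧-cong v≈0) ⟦⟧-zero)) -0#≈0#))
                         (*ₗ-zeroˡ u))
               (≈ᴹ-trans (*ₗ-congˡ v≈0) (*ₗ-zeroʳ _)))
      (+ᴹ-identityˡ _)

    ⟦combine⟧ : ∀ u v → ⟦ combine u v ⟧ ≈ 0#
    ⟦combine⟧ u v = begin
      ⟦ combine u v ⟧                          ≈⟨ ⟦⟧-ray _ _ _ ⟩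
      - ⟦ v ⟧ * ⟦ u ⟧ + ⟦ ⟦ u ⟧ *ₗ v ⟧          ≈⟨ +-congˡ (⟦⟧-cong (+ᴹ-identityʳ _)) ⟨
      - ⟦ v ⟧ * ⟦ u ⟧ + ⟦ ⟦ u ⟧ *ₗ v +ᴹ 0ᴹ ⟧    ≈⟨ +-cong (sym (-‿distribˡ-* _ _)) (⟦⟧-ray _ _ _) ⟩
      - (⟦ v ⟧ * ⟦ u ⟧) + (⟦ u ⟧ * ⟦ v ⟧ + ⟦ 0ᴹ ⟧)
        ≈⟨ +-congˡ (trans (+-congˡ ⟦⟧-zero) (+-identityʳ _)) ⟩
      - (⟦ v ⟧ * ⟦ u ⟧) + ⟦ u ⟧ * ⟦ v ⟧         ≈⟨ +-congˡ (*-comm _ _) ⟩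
      - (⟦ v ⟧ * ⟦ u ⟧) + ⟦ v ⟧ * ⟦ u ⟧         ≈⟨ -‿inverseˡ _ ⟩
      0#                                       ∎
      where open ≈-Reasoning setoid

    module _ (S : Pred Carrierᴹ 0ℓ) where

      S⁰ S⁺ S⁻ : Pred Carrierᴹ 0ℓ
      S⁰ p = S p × ⟦ p ⟧ ≈ 0#
      S⁺ p = S p × 0# < ⟦ p ⟧
      S⁻ p = S p × ⟦ p ⟧ < 0#

      data Sliced : Pred Carrierᴹ 0ℓ where
        level : ∀ {p} → S⁰ p → Sliced p
        cross : ∀ {p q} → S⁺ p → S⁻ q → Sliced (combine p q)

      sliced⊆ : Sliced ⊆ Cone S
      sliced⊆ (level (Sp , _))            = cone-gen Sp
      sliced⊆ (cross (Sp , 0<p) (Sq , q<0)) =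
        cone-+ (cone-* (<⇒≤ (neg-pos q<0)) (cone-gen Sp)) (cone-* (<⇒≤ 0<p) (cone-gen Sq))

      ⟦sliced⟧ : ∀ {p} → Sliced p → ⟦ p ⟧ ≈ 0#
      ⟦sliced⟧ (level (_ , p≈0)) = p≈0
      ⟦sliced⟧ (cross _ _)       = ⟦combine⟧ _ _

      record Split (v : Carrierᴹ) : Set where
        field
          {z u w} : Carrierᴹ
          zero⁰   : Cone S⁰ z
          pos⁺    : Cone S⁺ u
          neg⁻    : Cone S⁻ w
          sum     : v ≈ᴹ z +ᴹ (u +ᴹ w)

      split : ∀ {v} → Cone S v → Split v
      split (apex v≈0) = record
        { zero⁰ = apex ≈ᴹ-refl ; pos⁺ = apex ≈ᴹ-refl ; neg⁻ = apex ≈ᴹ-refl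
        ; sum = ≈ᴹ-trans v≈0 (≈ᴹ-sym (≈ᴹ-trans (+ᴹ-identityˡ _) (+ᴹ-identityˡ _))) }
      split (ray {k} {p} 0≤k Sp c e) with split c | em {⟦ p ⟧ ≤ 0#} | em {0# ≤ ⟦ p ⟧}
      ... | r | no 0<p | _ = record
        { zero⁰ = zero⁰ ; pos⁺ = ray 0≤k (Sp , 0<p) pos⁺ ≈ᴹ-refl ; neg⁻ = neg⁻
        ; sum = ≈ᴹ-trans e (≈ᴹ-trans (+ᴹ-congˡ sum)
                  (≈ᴹ-trans (x∙yz≈y∙xz _ _ _) (+ᴹ-congˡ (≈ᴹ-sym (+ᴹ-assoc _ _ _))))) }
        where open Split r
      ... | r | yes _ | no p<0 = record
        { zero⁰ = zero⁰ ; pos⁺ = pos⁺ ; neg⁻ = ray 0≤k (Sp , p<0) neg⁻ ≈ᴹ-refl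
        ; sum = ≈ᴹ-trans e (≈ᴹ-trans (+ᴹ-congˡ sum)
                  (≈ᴹ-trans (x∙yz≈y∙xz _ _ _) (+ᴹ-congˡ (x∙yz≈y∙xz _ _ _)))) }
        where open Split r
      ... | r | yes p≤0 | yes 0≤p = record
        { zero⁰ = ray 0≤k (Sp , antisym p≤0 0≤p) zero⁰ ≈ᴹ-refl ; pos⁺ = pos⁺ ; neg⁻ = neg⁻
        ; sum = ≈ᴹ-trans e (≈ᴹ-trans (+ᴹ-congˡ sum) (≈ᴹ-sym (+ᴹ-assoc _ _ _))) }
        where open Split r

      combine-point : ∀ {u q} → Cone S⁺ u → S⁻ q → Cone Sliced (combine u q)
      combine-point {q = q} (apex u≈0)        q⁻ = apex (combine-zeroˡ q u≈0)
      combine-point {q = q} (ray 0≤k p⁺ c e) q⁻ = cone-resp-≈ (≈ᴹ-sym (combine-rayˡ q e))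
        (cone-+ (cone-* 0≤k (cone-gen (cross p⁺ q⁻))) (combine-point c q⁻))

      -- Linearity in each argument expands `combine u w` into a nonnegative combination of the
      -- `combine p q` with p in `S⁺` and q in `S⁻`.
      combine-cone : ∀ {u w} → Cone S⁺ u → Cone S⁻ w → Cone Sliced (combine u w)
      combine-cone {u} c (apex w≈0)        = apex (combine-zeroʳ u w≈0)
      combine-cone {u} c (ray 0≤k q⁻ d e) = cone-resp-≈ (≈ᴹ-sym (combine-rayʳ u e))
        (cone-+ (cone-* 0≤k (combine-point c q⁻)) (combine-cone c d))

      -- If s = ⟦ u ⟧ = − ⟦ w ⟧ > 0 then u + w = s⁻¹ combine u w.
      slice-complete : ∀ {v} → Cone S v → ⟦ v ⟧ ≈ 0# → Cone Sliced v
      slice-complete {v} c v≈0 = cone-resp-≈ (≈ᴹ-sym sum)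
        (cone-+ (cone-bind (λ p⁰ → cone-gen (level p⁰)) zero⁰) u+w∈)
        where
        open Split (split c)
        open ≈-Reasoning setoid

        -w≈u : - ⟦ w ⟧ ≈ ⟦ u ⟧
        -w≈u = begin
          - ⟦ w ⟧                              ≈⟨ +-identityˡ _ ⟨
          0# + - ⟦ w ⟧                         ≈⟨ +-congʳ v≈0 ⟨
          ⟦ v ⟧ + - ⟦ w ⟧                      ≈⟨ +-congʳ (⟦⟧-cong sum) ⟩
          ⟦ z +ᴹ (u +ᴹ w) ⟧ + - ⟦ w ⟧          ≈⟨ +-congʳ (trans (⟦⟧-+ _ _) (+-congˡ (⟦⟧-+ _ _))) ⟩
          ⟦ z ⟧ + (⟦ u ⟧ + ⟦ w ⟧) + - ⟦ w ⟧    ≈⟨ +-congʳ (+-congʳ (cone-zero proj₂ zero⁰)) ⟩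
          0# + (⟦ u ⟧ + ⟦ w ⟧) + - ⟦ w ⟧       ≈⟨ +-congʳ (+-identityˡ _) ⟩
          ⟦ u ⟧ + ⟦ w ⟧ + - ⟦ w ⟧              ≈⟨ +-assoc _ _ _ ⟩
          ⟦ u ⟧ + (⟦ w ⟧ + - ⟦ w ⟧)            ≈⟨ +-congˡ (-‿inverseʳ _) ⟩
          ⟦ u ⟧ + 0#                           ≈⟨ +-identityʳ _ ⟩
          ⟦ u ⟧                                ∎

        combine≈ : combine u w ≈ᴹ ⟦ u ⟧ *ₗ (u +ᴹ w)
        combine≈ = ≈ᴹ-trans (+ᴹ-congʳ (*ₗ-congʳ -w≈u)) (≈ᴹ-sym (*ₗ-distribˡ _ _ _))

        u+w∈ : Cone Sliced (u +ᴹ w)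
        u+w∈ with cone-positive proj₂ pos⁺
                | Functional.cone-positive (negate a) (neg-pos ∘ proj₂) neg⁻
        ... | inj₁ u≈0 | inj₁ w≈0 = apex (≈ᴹ-trans (+ᴹ-cong u≈0 w≈0) (+ᴹ-identityˡ _))
        -- With u at the apex, `-w≈u` makes the value of w zero, against its strict negativity.
        ... | inj₁ u≈0 | inj₂ 0<-w =
          contradiction (trans -w≈u (trans (⟦⟧-cong u≈0) ⟦⟧-zero)) (<⇒≉ 0<-w)
        ... | inj₂ 0<u | _ with reciprocal 0<u
        ... | r , 0<r , ru≈1 = cone-resp-≈ scaled (cone-* (<⇒≤ 0<r) (combine-cone pos⁺ neg⁻))
          where
          scaled : r *ₗ combine u w ≈ᴹ u +ᴹ w
          scaled = ≈ᴹ-trans (*ₗ-congˡ combine≈) (≈ᴹ-trans (≈ᴹ-sym (*ₗ-assoc r _ _))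
            (≈ᴹ-trans (*ₗ-congʳ ru≈1) (*ₗ-identityˡ _)))

-- Relations between indicator functions of polytopes

module Polytopes (em : ExcludedMiddle 0ℓ) (ℝ : CompleteOrderedField) where
  open OrderedField ℝ

  -- Points of ℝⁿ are represented projectively, by n coordinates followed by a mass.
  Space : ℕ → LeftModule ring 0ℓ 0ℓ
  Space zero    = TensorUnit.leftModule
  Space (suc n) = DirectProduct.leftModule TensorUnit.leftModule (Space n)

  module V n = LeftModule (Space n)
  module C n = Cones em ℝ (Space n)

  open Cones.Functional

  mass : ∀ n → C.Functional n
  mass zero = record
    { ⟦_⟧ = id ; ⟦⟧-cong = id ; ⟦⟧-zero = refl ; ⟦⟧-ray = λ _ _ _ → refl }
  mass (suc n) = record
    { ⟦_⟧     = λ v → ⟦ mass n ⟧ (proj₂ v)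
    ; ⟦⟧-cong = λ e → ⟦⟧-cong (mass n) (proj₂ e)
    ; ⟦⟧-zero = ⟦⟧-zero (mass n)
    ; ⟦⟧-ray  = λ k p u → ⟦⟧-ray (mass n) k (proj₂ p) (proj₂ u)
    }

  point : ∀ n → Carrier → (Fin n → Carrier) → V.Carrierᴹ n
  point zero    m x = m
  point (suc n) m x = x zero , point n m (x ∘ suc)

  mass-point : ∀ n m x → ⟦ mass n ⟧ (point n m x) ≈ m
  mass-point zero    m x = refl
  mass-point (suc n) m x = mass-point n m (x ∘ suc)

  scale : ∀ n → Carrier → C.Functional n → C.Functional n
  scale n t φ = record
    { ⟦_⟧     = λ v → t * ⟦ φ ⟧ v
    ; ⟦⟧-cong = λ e → *-congˡ (⟦⟧-cong φ e)
    ; ⟦⟧-zero = trans (*-congˡ (⟦⟧-zero φ)) (zeroʳ t)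
    ; ⟦⟧-ray  = λ k p u → trans (*-congˡ (⟦⟧-ray φ k p u))
        (trans (distribˡ t _ _) (+-congʳ (x∙yz≈y∙xz t k _)))
    }
    where open CommutativeSemigroupProperties *-commutativeSemigroup using (x∙yz≈y∙xz)

  -- The kernel is the graph of φ over the remaining coordinates. Both the slices x₁ = t and the
  -- lifted base polytopes are described by such graphs.
  gap : ∀ n → C.Functional n → C.Functional (suc n)
  gap n φ = record
    { ⟦_⟧     = λ v → proj₁ v + - ⟦ φ ⟧ (proj₂ v)
    ; ⟦⟧-cong = λ e → +-cong (proj₁ e) (-‿cong (⟦⟧-cong φ (proj₂ e)))
    ; ⟦⟧-zero = trans (+-identityˡ _) (trans (-‿cong (⟦⟧-zero φ)) -0#≈0#)
    ; ⟦⟧-ray  = λ k (x , p) (y , u) → begin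
        k * x + y + - ⟦ φ ⟧ (k *ₗ p +ᴹ u)             ≈⟨ +-congˡ (-‿cong (⟦⟧-ray φ k p u)) ⟩
        k * x + y + - (k * ⟦ φ ⟧ p + ⟦ φ ⟧ u)         ≈⟨ +-congˡ (-‿+-comm _ _) ⟨
        k * x + y + (- (k * ⟦ φ ⟧ p) + - ⟦ φ ⟧ u)     ≈⟨ interchange _ _ _ _ ⟩
        k * x + - (k * ⟦ φ ⟧ p) + (y + - ⟦ φ ⟧ u)     ≈⟨ +-congʳ (+-congˡ (-‿distribʳ-* k _)) ⟩
        k * x + k * - ⟦ φ ⟧ p + (y + - ⟦ φ ⟧ u)       ≈⟨ +-congʳ (distribˡ k _ _) ⟨
        k * (x + - ⟦ φ ⟧ p) + (y + - ⟦ φ ⟧ u)         ∎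
    }
    where
    open ≈-Reasoning setoid
    open V n using (_*ₗ_; _+ᴹ_)
    open CommutativeSemigroupProperties +-commutativeSemigroup using (interchange)

  gap≈0⇒ : ∀ n φ (p : V.Carrierᴹ (suc n)) → ⟦ gap n φ ⟧ p ≈ 0# → proj₁ p ≈ ⟦ φ ⟧ (proj₂ p)
  gap≈0⇒ n φ (x , v) gap≈0 = begin
    x                              ≈⟨ +-identityʳ x ⟨
    x + 0#                         ≈⟨ +-congˡ (-‿inverseˡ _) ⟨
    x + (- ⟦ φ ⟧ v + ⟦ φ ⟧ v)      ≈⟨ +-assoc _ _ _ ⟨
    x + - ⟦ φ ⟧ v + ⟦ φ ⟧ v        ≈⟨ +-congʳ gap≈0 ⟩
    0# + ⟦ φ ⟧ v                   ≈⟨ +-identityˡ _ ⟩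
    ⟦ φ ⟧ v                        ∎
    where open ≈-Reasoning setoid

  gap≈0⇐ : ∀ n φ (p : V.Carrierᴹ (suc n)) → proj₁ p ≈ ⟦ φ ⟧ (proj₂ p) → ⟦ gap n φ ⟧ p ≈ 0#
  gap≈0⇐ n φ p p≈ = trans (+-congʳ p≈) (-‿inverseʳ _)

  -- On points of mass 1 this is x₁ − t.
  height : ∀ n → Carrier → C.Functional (suc n)
  height n t = gap n (scale n t (mass n))

  -- Raising the level from c to t lowers the height by (t - c) times the mass; both monotonicity
  -- statements below come from this.
  height-shift : ∀ n c t (p : V.Carrierᴹ (suc n)) →
    ⟦ height n c ⟧ p ≈ ⟦ height n t ⟧ p + (t + - c) * ⟦ mass (suc n) ⟧ p
  height-shift n c t p@(x , v) = sym (begin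
    x + - (t * m) + (t + - c) * m           ≈⟨ +-assoc _ _ _ ⟩
    x + (- (t * m) + (t + - c) * m)         ≈⟨ +-congˡ (+-congˡ (distribʳ m t (- c))) ⟩
    x + (- (t * m) + (t * m + - c * m))     ≈⟨ +-congˡ (+-assoc _ _ _) ⟨
    x + (- (t * m) + t * m + - c * m)       ≈⟨ +-congˡ (+-congʳ (-‿inverseˡ _)) ⟩
    x + (0# + - c * m)                      ≈⟨ +-congˡ (+-identityˡ _) ⟩
    x + - c * m                             ≈⟨ +-congˡ (-‿distribˡ-* c m) ⟨
    x + - (c * m)                           ∎)
    where
    open ≈-Reasoning setoid
    m : Carrier
    m = ⟦ mass n ⟧ v

  module _ n {c t : Carrier} (p : V.Carrierᴹ (suc n)) where

    height-antitone : 0# < ⟦ mass (suc n) ⟧ p → c ≤ t → ⟦ height n t ⟧ p ≤ ⟦ height n c ⟧ p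
    height-antitone 0<m c≤t = ≤-respˡ-≈ (+-identityʳ _) (≤-respʳ-≈ (sym (height-shift n c t p))
      (+-monoʳ-≤ (⟦ height n t ⟧ p)
        (*-nonneg (≤-respˡ-≈ (-‿inverseʳ c) (+-monoˡ-≤ ℝ (- c) c≤t)) (<⇒≤ 0<m))))

    height-decreasing : 0# < ⟦ mass (suc n) ⟧ p → c < t → ⟦ height n t ⟧ p < ⟦ height n c ⟧ p
    height-decreasing 0<m c<t hc≤ht = *-pos 0<t-c 0<m
      (+-cancelˡ-≤ ℝ (⟦ height n t ⟧ p)
        (≤-respʳ-≈ (sym (+-identityʳ _)) (≤-respˡ-≈ (height-shift n c t p) hc≤ht)))
      where
      0<t-c : 0# < t + - c
      0<t-c t-c≤0 = c<t (+-cancelʳ-≤ ℝ (- c) (≤-respʳ-≈ (sym (-‿inverseʳ c)) t-c≤0))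

  module _ n (p : V.Carrierᴹ (suc n)) (0<m : 0# < ⟦ mass (suc n) ⟧ p) where

    ratio : ∃[ c ] ⟦ height n c ⟧ p ≈ 0#
    ratio with reciprocal 0<m
    ... | m⁻¹ , _ , m⁻¹m≈1 = proj₁ p * m⁻¹ , trans
      (+-congˡ (-‿cong (trans (*-assoc _ _ _) (trans (*-congˡ m⁻¹m≈1) (*-identityʳ _)))))
      (-‿inverseʳ _)

    height-stays-positive : ∀ c → ∃[ t ] c < t × (0# < ⟦ height n c ⟧ p → 0# < ⟦ height n t ⟧ p)
    height-stays-positive c with em {⟦ height n c ⟧ p ≤ 0#} | reciprocal (+-pos 0<m (0≤1 ℝ))
    -- The implication is vacuous here, so any level above c will do.
    ... | yes h≤0 | _ = c + 1# , x<x+y c 0<1 , contradiction h≤0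
    -- With δ = h / (m + 1), the height at level c + δ is h - δ m = δ, still positive; dividing by m
    -- instead would lower it to 0.
    ... | no 0<h  | r , 0<r , r[m+1]≈1 =
      c + δ , x<x+y c 0<δ , λ _ h≤0 → 0<δ (≤-respˡ-≈ ht≈δ h≤0)
      where
      open ≈-Reasoning setoid
      m h δ : Carrier
      m = ⟦ mass (suc n) ⟧ p
      h = ⟦ height n c ⟧ p
      δ = h * r
      0<δ : 0# < δ
      0<δ = *-pos 0<h 0<r
      t-c≈δ : c + δ + - c ≈ δ
      t-c≈δ = trans (+-congʳ (+-comm c δ)) (trans (+-assoc _ _ _)
        (trans (+-congˡ (-‿inverseʳ c)) (+-identityʳ δ)))
      sums : ⟦ height n (c + δ) ⟧ p + δ * m ≈ δ + δ * m
      sums = begin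
        ⟦ height n (c + δ) ⟧ p + δ * m              ≈⟨ +-congˡ (*-congʳ t-c≈δ) ⟨
        ⟦ height n (c + δ) ⟧ p + (c + δ + - c) * m  ≈⟨ height-shift n c (c + δ) p ⟨
        h                                         ≈⟨ *-identityʳ h ⟨
        h * 1#                                    ≈⟨ *-congˡ r[m+1]≈1 ⟨
        h * (r * (m + 1#))                        ≈⟨ *-assoc _ _ _ ⟨
        δ * (m + 1#)                              ≈⟨ distribˡ δ m 1# ⟩
        δ * m + δ * 1#                            ≈⟨ +-congˡ (*-identityʳ δ) ⟩
        δ * m + δ                                 ≈⟨ +-comm _ _ ⟩
        δ + δ * m                                 ∎
      ht≈δ : ⟦ height n (c + δ) ⟧ p ≈ δ
      ht≈δ = antisym (+-cancelʳ-≤ ℝ (δ * m) (≤-reflexive sums))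
                     (+-cancelʳ-≤ ℝ (δ * m) (≤-reflexive (sym sums)))

  -- The polytope consists of the points of mass 1 in the cone of the generators. Their masses are
  -- only positive, because `combine` does not preserve mass 1.
  record Polytope (n : ℕ) : Set where
    constructor hull
    field
      generators : List (V.Carrierᴹ n)
      massive    : ∀ {p} → p ∈ generators → 0# < ⟦ mass n ⟧ p
  open Polytope

  Member : ∀ {n} → (Fin n → Carrier) → Pred (Polytope n) 0ℓ
  Member {n} x K = C.Cone n (_∈ generators K) (point n 1# x)

  -- A generator has positive mass and can be rescaled to a point of the polytope, so the list alone
  -- decides non-emptiness.
  Inhabited : ∀ {n} → Pred (Polytope n) 0ℓ
  Inhabited K = ∃[ p ] p ∈ generators K

  -- This says that max x₁ = c on K, tested on generators, where a linear function attains its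
  -- maximum.
  Top : ∀ {n} → Carrier → Pred (Polytope (suc n)) 0ℓ
  Top {n} c K = (∃[ p ] p ∈ generators K × ⟦ height n c ⟧ p ≈ 0#) ×
                (∀ {p} → p ∈ generators K → ⟦ height n c ⟧ p ≤ 0#)

  -- Slices of a polytope

  module _ {n} (t : Carrier) (K : Polytope (suc n)) where
    open C.Slice (suc n) (height n t) using (combine; Sliced; level; cross)

    private
      G : List (V.Carrierᴹ (suc n))
      G = generators K
      crosses : List (V.Carrierᴹ (suc n) × V.Carrierᴹ (suc n))
      crosses = filter (λ (p , q) → em {0# < ⟦ height n t ⟧ p × ⟦ height n t ⟧ q < 0#})
                       (cartesianProduct G G)
      levels : List (V.Carrierᴹ (suc n))
      levels = filter (λ p → em {⟦ height n t ⟧ p ≈ 0#}) G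

    sliceGenerators : List (V.Carrierᴹ n)
    sliceGenerators = map proj₂ (levels ++ map (uncurry combine) crosses)

    ∈-slice⁺ : ∀ {p} → Sliced (_∈ G) p → proj₂ p ∈ sliceGenerators
    ∈-slice⁺ (level (p∈ , p≈0)) = ∈-map⁺ proj₂ (∈-++⁺ˡ (∈-filter⁺ _ p∈ p≈0))
    ∈-slice⁺ (cross (p∈ , 0<p) (q∈ , q<0)) = ∈-map⁺ proj₂ (∈-++⁺ʳ levels
      (∈-map⁺ (uncurry combine) (∈-filter⁺ _ (∈-cartesianProduct⁺ p∈ q∈) (0<p , q<0))))

    ∈-slice⁻ : ∀ {v} → v ∈ sliceGenerators → ∃[ p ] Sliced (_∈ G) p × v ≡ proj₂ p
    ∈-slice⁻ v∈ with ∈-map⁻ proj₂ v∈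
    ... | p , p∈ , eq with ∈-++⁻ levels p∈
    ... | inj₁ p∈levels = p , level (∈-filter⁻ _ p∈levels) , eq
    ... | inj₂ p∈crosses with ∈-map⁻ (uncurry combine) p∈crosses
    ... | (q , r) , qr∈ , ≡.refl with ∈-filter⁻ _ {xs = cartesianProduct G G} qr∈
    ... | qr∈G , 0<q , r<0 with ∈-cartesianProduct⁻ G G qr∈G
    ... | q∈ , r∈ = _ , cross (q∈ , 0<q) (r∈ , r<0) , eq

  slice : ∀ {n} → Carrier → Polytope (suc n) → Polytope n
  slice {n} t K = hull (sliceGenerators t K) λ v∈ → positive (∈-slice⁻ t K v∈)
    where
    open C.Slice (suc n) (height n t)
    positive : ∀ {v} → ∃[ p ] Sliced (_∈ generators K) p × v ≡ proj₂ p → 0# < ⟦ mass n ⟧ v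
    positive (_ , level (p∈ , _) , ≡.refl) = massive K p∈
    -- The mass of `combine p q` is that of p times - ⟦ q ⟧ plus that of q times ⟦ p ⟧, and both
    -- terms are positive.
    positive (_ , cross {p} {q} (p∈ , 0<p) (q∈ , q<0) , ≡.refl) = λ ≤0 →
      +-pos (*-pos (neg-pos q<0) (massive K p∈)) (<⇒≤ (*-pos 0<p (massive K q∈)))
        (≤-respˡ-≈ (trans (⟦⟧-ray (mass n) _ _ _) (+-congˡ (mass-* _ (proj₂ q)))) ≤0)
      where
      open V n using (_*ₗ_; 0ᴹ; +ᴹ-identityʳ)
      mass-* : ∀ k v → ⟦ mass n ⟧ (k *ₗ v) ≈ k * ⟦ mass n ⟧ v
      mass-* k v = trans (⟦⟧-cong (mass n) (V.≈ᴹ-sym n (+ᴹ-identityʳ _)))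
        (trans (⟦⟧-ray (mass n) k v 0ᴹ) (trans (+-congˡ (⟦⟧-zero (mass n))) (+-identityʳ _)))

  module _ (n : ℕ) {S : Pred (V.Carrierᴹ (suc n)) 0ℓ} {T : Pred (V.Carrierᴹ n) 0ℓ} where

    cone-proj₂ : (∀ {p} → S p → T (proj₂ p)) → ∀ {v} → C.Cone (suc n) S v → C.Cone n T (proj₂ v)
    cone-proj₂ S⇒T (C.apex v≈0)       = C.apex {n} (proj₂ v≈0)
    cone-proj₂ S⇒T (C.ray 0≤k Sp c e) = C.ray {n} 0≤k (S⇒T Sp) (cone-proj₂ S⇒T c) (proj₂ e)

    -- The map v ↦ (⟦ φ ⟧ v , v) is linear, so it suffices to know where it sends generators. It
    -- restores the first coordinate that `slice` has dropped.
    cone-graph : ∀ φ → (∀ {p} → T p → C.Cone (suc n) S (⟦ φ ⟧ p , p)) →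
                 ∀ {v} → C.Cone n T v → C.Cone (suc n) S (⟦ φ ⟧ v , v)
    cone-graph φ lift (C.apex v≈0) = C.apex {suc n} (trans (⟦⟧-cong φ v≈0) (⟦⟧-zero φ) , v≈0)
    cone-graph φ lift (C.ray 0≤k Tp c e) = C.cone-resp-≈ (suc n)
      (sym (C.Functional.⟦⟧-ray-≈ n φ e) , V.≈ᴹ-sym n e)
      (C.cone-+ (suc n) (C.cone-* (suc n) 0≤k (lift Tp)) (cone-graph φ lift c))

  Member-slice⁺ : ∀ {n} t (x : Fin n → Carrier) (K : Polytope (suc n)) →
                  Member (t Vector.∷ x) K → Member x (slice t K)
  Member-slice⁺ {n} t x K c = cone-proj₂ n (∈-slice⁺ t K)
    (C.Slice.slice-complete (suc n) (height n t) (_∈ generators K) c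
      (gap≈0⇐ n (scale n t (mass n)) _ (sym (trans (*-congˡ (mass-point n 1# x)) (*-identityʳ t)))))

  Member-slice⁻ : ∀ {n} t (x : Fin n → Carrier) (K : Polytope (suc n)) →
                  Member x (slice t K) → Member (t Vector.∷ x) K
  Member-slice⁻ {n} t x K c = C.cone-resp-≈ (suc n)
    (trans (*-congˡ (mass-point n 1# x)) (*-identityʳ t) , V.≈ᴹ-refl n)
    (cone-graph n (scale n t (mass n)) (λ v∈ → lift (∈-slice⁻ t K v∈)) c)
    where
    open C.Slice (suc n) (height n t)
    lift : ∀ {v} → ∃[ p ] Sliced (_∈ generators K) p × v ≡ proj₂ p →
           C.Cone (suc n) (_∈ generators K) (t * ⟦ mass n ⟧ v , v)
    lift (p , sliced , ≡.refl) = C.cone-resp-≈ (suc n)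
      (gap≈0⇒ n (scale n t (mass n)) p (⟦sliced⟧ _ sliced) , V.≈ᴹ-refl n) (sliced⊆ _ sliced)

  module _ {n} (t : Carrier) (K : Polytope (suc n)) where
    open C.Slice (suc n) (height n t)

    private
      G : List (V.Carrierᴹ (suc n))
      G = generators K

    -- If neither generator lies on the hyperplane, the two lie strictly on opposite sides and their
    -- crossing is a generator of the slice.
    Inhabited-slice⁺ : (∃[ p ] p ∈ G × ⟦ height n t ⟧ p ≤ 0#) →
                       (∃[ p ] p ∈ G × 0# ≤ ⟦ height n t ⟧ p) → Inhabited (slice t K)
    Inhabited-slice⁺ (p , p∈ , p≤0) (q , q∈ , 0≤q)
      with em {0# ≤ ⟦ height n t ⟧ p} | em {⟦ height n t ⟧ q ≤ 0#}
    ... | yes 0≤p | _       = _ , ∈-slice⁺ t K (level (p∈ , antisym p≤0 0≤p))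
    ... | no _    | yes q≤0 = _ , ∈-slice⁺ t K (level (q∈ , antisym q≤0 0≤q))
    ... | no p<0  | no 0<q  = _ , ∈-slice⁺ t K (cross (q∈ , 0<q) (p∈ , p<0))

    Inhabited-slice⁻ : Inhabited (slice t K) → (∃[ p ] p ∈ G × ⟦ height n t ⟧ p ≤ 0#) ×
                                               (∃[ p ] p ∈ G × 0# ≤ ⟦ height n t ⟧ p)
    Inhabited-slice⁻ (_ , v∈) with ∈-slice⁻ t K v∈
    ... | _ , level (p∈ , p≈0) , _ = (_ , p∈ , ≤-reflexive p≈0) , (_ , p∈ , ≤-reflexive (sym p≈0))
    ... | _ , cross (p∈ , 0<p) (q∈ , q<0) , _ = (_ , q∈ , <⇒≤ q<0) , (_ , p∈ , <⇒≤ 0<p)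

  -- Each condition passes to smaller levels, so the smallest of finitely many witnesses serves all
  -- of them.
  eventually : ∀ {A : Set} (Q : Carrier → A → Set) c →
               (∀ {t t′ x} → t ≤ t′ → Q t′ x → Q t x) →
               ∀ (xs : List A) → (∀ {x} → x ∈ xs → ∃[ t ] c < t × Q t x) →
               ∃[ t ] c < t × (∀ {x} → x ∈ xs → Q t x)
  eventually Q c anti []       ex = c + 1# , x<x+y c 0<1 , λ ()
  eventually Q c anti (x ∷ xs) ex with ex (here ≡.refl) | eventually Q c anti xs (ex ∘ there)
  ... | t , c<t , Qtx | s , c<s , Qs with total t s
  ... | inj₁ t≤s = t , c<t , λ { (here ≡.refl) → Qtx ; (there x∈) → anti t≤s (Qs x∈) }
  ... | inj₂ s≤t = s , c<s , λ { (here ≡.refl) → anti s≤t Qtx ; (there x∈) → Qs x∈ }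

  just-above : ∀ {n} c (Ks : List (Polytope (suc n))) → ∃[ t ] c < t × (∀ {K} → K ∈ Ks →
               ∀ {p} → p ∈ generators K → 0# < ⟦ height n c ⟧ p → 0# < ⟦ height n t ⟧ p)
  just-above {n} c Ks = eventually StaysPositive c
    (λ {_} {_} {K} t≤t′ stays p∈ 0<p →
      <-≤-trans (stays p∈ 0<p) (height-antitone n _ (massive K p∈) t≤t′))
    Ks λ {K} _ → map₂ (map₂ λ stays {p} p∈ → stays p∈ (massive K p∈))
      (eventually StaysPositiveAt c
        (λ {_} {_} {p} t≤t′ stays 0<m 0<p →
          <-≤-trans (stays 0<m 0<p) (height-antitone n p 0<m t≤t′))
        (generators K) λ {p} p∈ →
          map₂ (map₂ λ stays _ → stays) (height-stays-positive n p (massive K p∈) c))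
    where
    -- `eventually` wants inheritance at every point, listed or not; the mass hypothesis is
    -- therefore part of the predicate.
    StaysPositiveAt : Carrier → V.Carrierᴹ (suc n) → Set
    StaysPositiveAt t p = 0# < ⟦ mass (suc n) ⟧ p → 0# < ⟦ height n c ⟧ p → 0# < ⟦ height n t ⟧ p

    StaysPositive : Carrier → Polytope (suc n) → Set
    StaysPositive t K = ∀ {p} → p ∈ generators K → 0# < ⟦ height n c ⟧ p → 0# < ⟦ height n t ⟧ p

  -- Largest first coordinates and the Euler characteristic

  private
    -- The level sought is the largest of the ratios x₁ / mass; the list and its positivity are
    -- separate arguments so that the recursion is on the list.
    top-list : ∀ n (G : List (V.Carrierᴹ (suc n))) (pos : ∀ {p} → p ∈ G → 0# < ⟦ mass (suc n) ⟧ p) →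
               (∃[ p ] p ∈ G) → ∃[ c ] Top c (hull {suc n} G pos)
    top-list n []          pos (_ , ())
    top-list n (p ∷ []) pos _ with ratio n p (pos (here ≡.refl))
    ... | c , h≈0 = c , (p , here ≡.refl , h≈0) , λ { (here ≡.refl) → ≤-reflexive h≈0 }
    top-list n (p ∷ G@(q ∷ _)) pos _
      with top-list n G (pos ∘ there) (q , here ≡.refl) | ratio n p (pos (here ≡.refl))
    ... | c , (r , r∈ , hr≈0) , max | c′ , hp≈0 with total (⟦ height n c ⟧ p) 0#
    ... | inj₁ hp≤0 = c , (r , there r∈ , hr≈0) , λ { (here ≡.refl) → hp≤0 ; (there s∈) → max s∈ }
    ... | inj₂ 0≤hp = c′ , (p , here ≡.refl , hp≈0) , λ
      { (here ≡.refl) → ≤-reflexive hp≈0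
      ; (there s∈)    → ≤-trans (height-antitone n _ (pos (there s∈)) c≤c′) (max s∈) }
      where
      -- If c′ < c, then p would have negative height at c, since its height at c′ is 0.
      c≤c′ : c ≤ c′
      c≤c′ with em {c ≤ c′}
      ... | yes c≤c′ = c≤c′
      ... | no c′<c  = contradiction (≤-respˡ-≈ (sym hp≈0) 0≤hp)
                         (height-decreasing n p (pos (here ≡.refl)) c′<c)

  Top⇒Inhabited : ∀ {n c} (K : Polytope (suc n)) → Top c K → Inhabited K
  Top⇒Inhabited K ((p , p∈ , _) , _) = p , p∈

  Top-unique : ∀ {n c c′} (K : Polytope (suc n)) → Top c K → Top c′ K → c ≤ c′
  Top-unique {n} {c} {c′} K ((p , p∈ , hp≈0) , _) (_ , max) with em {c ≤ c′}
  ... | yes c≤c′ = c≤c′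
  ... | no c′<c  = contradiction (≤-respʳ-≈ (sym hp≈0) (max p∈))
                     (height-decreasing n p (massive K p∈) c′<c)

  Top-cong : ∀ {n c c′} (K : Polytope (suc n)) → c ≈ c′ → Top c K → Top c′ K
  Top-cong {n} {c} {c′} K c≈c′ ((p , p∈ , hp≈0) , max) =
    (p , p∈ , trans (sym (h≈ p)) hp≈0) , λ {q} q∈ → ≤-respˡ-≈ (h≈ q) (max q∈)
    where
    h≈ : ∀ q → ⟦ height n c ⟧ q ≈ ⟦ height n c′ ⟧ q
    h≈ q = +-congˡ (-‿cong (*-congʳ c≈c′))

  -- The level t is so close above c that every generator strictly above c is strictly above t. A
  -- listed polytope meeting x₁ = c thus either meets x₁ = t or has top c, and never both.
  ∑-Top : ∀ {n} (L : List (ℤ × Polytope (suc n))) →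
          (∀ t → ∑ em L (Inhabited ∘ slice t) ≡ 0ℤ) → ∀ c → ∑ em L (Top c) ≡ 0ℤ
  ∑-Top {n} L slices c with just-above c (map proj₂ L)
  ... | t , c<t , above = begin
    ∑ em L (Top c)                                        ≡⟨ ℤₚ.+-identityˡ _ ⟨
    0ℤ ℤ.+ ∑ em L (Top c)                                 ≡⟨ cong (ℤ._+ ∑ em L (Top c)) (slices t) ⟨
    ∑ em L (Inhabited ∘ slice t) ℤ.+ ∑ em L (Top c)       ≡⟨ ∑-∪ em L (λ {K} → disjoint K) ⟨
    ∑ em L ((Inhabited ∘ slice t) ∪ Top c)
      ≡⟨ ∑-cong-∈ em L (λ K∈ → to _ K∈ , from _ K∈) ⟩
    ∑ em L (Inhabited ∘ slice c)                          ≡⟨ slices c ⟩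
    0ℤ                                                    ∎
    where
    open ≡-Reasoning
    positive : ∀ (K : Polytope (suc n)) {p} → p ∈ generators K →
               0# ≤ ⟦ height n t ⟧ p → 0# < ⟦ height n c ⟧ p
    positive K p∈ 0≤p = ≤-<-trans 0≤p (height-decreasing n _ (massive K p∈) c<t)

    disjoint : ∀ (K : Polytope (suc n)) → Inhabited (slice t K) → ¬ Top c K
    disjoint K s (_ , max) with Inhabited-slice⁻ t K s
    ... | _ , (p , p∈ , 0≤p) = positive K p∈ 0≤p (max p∈)

    to : ∀ K → K ∈ map proj₂ L → Inhabited (slice t K) ⊎ Top c K → Inhabited (slice c K)
    to K K∈ (inj₂ ((p , p∈ , p≈0) , _)) = Inhabited-slice⁺ c K
      (p , p∈ , ≤-reflexive p≈0) (p , p∈ , ≤-reflexive (sym p≈0))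
    to K K∈ (inj₁ s) with Inhabited-slice⁻ t K s
    ... | (p , p∈ , p≤0) , (q , q∈ , 0≤q) with em {⟦ height n c ⟧ p ≤ 0#}
    ... | yes hcp≤0 = Inhabited-slice⁺ c K (p , p∈ , hcp≤0) (q , q∈ , <⇒≤ (positive K q∈ 0≤q))
    -- By the choice of t, a generator strictly above c cannot be at or below t.
    ... | no 0<hcp  = contradiction p≤0 (above K∈ p∈ 0<hcp)

    from : ∀ K → K ∈ map proj₂ L → Inhabited (slice c K) → Inhabited (slice t K) ⊎ Top c K
    -- A generator strictly above c makes K reach t. If there is none, the generator at or above c
    -- lies exactly on x₁ = c and is a maximum.
    from K K∈ s with Inhabited-slice⁻ c K s | em {∃[ q ] q ∈ generators K × 0# < ⟦ height n c ⟧ q}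
    ... | (p , p∈ , p≤0) , _ | yes (q , q∈ , 0<q) = inj₁ (Inhabited-slice⁺ t K
      (p , p∈ , ≤-trans (height-antitone n p (massive K p∈) (<⇒≤ c<t)) p≤0)
      (q , q∈ , <⇒≤ (above K∈ q∈ 0<q)))
    ... | _ , (q , q∈ , 0≤q) | no none = inj₂ ((q , q∈ , antisym (max q∈) 0≤q) , max)
      where
      max : ∀ {p} → p ∈ generators K → ⟦ height n c ⟧ p ≤ 0#
      max {p} p∈ with em {⟦ height n c ⟧ p ≤ 0#}
      ... | yes p≤0 = p≤0
      ... | no 0<p  = contradiction (p , p∈ , 0<p) none

  ∑-Inhabited : ∀ n (L : List (ℤ × Polytope n)) →
                (∀ x → ∑ em L (Member x) ≡ 0ℤ) → ∑ em L Inhabited ≡ 0ℤ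
  -- Stated separately because lifted base polytopes later feed it directly to `∑-Top`.
  ∑-Inhabited-slice : ∀ n (L : List (ℤ × Polytope (suc n))) → (∀ x → ∑ em L (Member x) ≡ 0ℤ) →
                      ∀ t → ∑ em L (Inhabited ∘ slice t) ≡ 0ℤ

  -- ℝ⁰ has a single point, and a polytope there is nonempty exactly if it contains this point.
  ∑-Inhabited zero L relation = ≡.trans
    (∑-cong em L (λ {K} → member K) (λ {K} → inhabited K)) (relation λ ())
    where
    member : ∀ (K : Polytope 0) → Inhabited K → Member (λ ()) K
    member K (p , p∈) with reciprocal (massive K p∈)
    ... | r , 0<r , rp≈1 = C.cone-resp-≈ 0 rp≈1 (C.cone-* 0 (<⇒≤ 0<r) (C.cone-gen 0 p∈))
    inhabited : ∀ (K : Polytope 0) → Member (λ ()) K → Inhabited K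
    inhabited K (C.apex 1≈0)     = contradiction (sym 1≈0) 0≉1
    inhabited K (C.ray {p = p} _ p∈ _ _) = p , p∈
  ∑-Inhabited (suc n) L relation = ≡.trans
    (∑-cong em L (λ {K} → top-list n (generators K) (massive K))
                 (λ {K} (_ , top) → Top⇒Inhabited K top))
    -- A nonempty polytope has a top level, unique up to ≈, so non-emptiness splits into the classes
    -- `Top c`.
    (∑-∃ em Top
      (λ {c} {c′} {K} top top′ {K′} → Top-cong K′
        (antisym (Top-unique K top top′) (Top-unique K top′ top)))
      L (∑-Top L (∑-Inhabited-slice n L relation)))

  ∑-Inhabited-slice n L relation t = ≡.trans (≡.sym (∑-map em (slice t) {Inhabited} L))
    (∑-Inhabited n (map (map₂ (slice t)) L) λ x → ≡.trans (∑-map em (slice t) {Member x} L) (≡.trans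
      (∑-cong em L (λ {K} → Member-slice⁻ t x K) (λ {K} → Member-slice⁺ t x K))
      (relation (t Vector.∷ x))))

-- Weights of subsets

subsets : ∀ d → List (Subset d)
subsets zero    = [] ∷ []
subsets (suc d) = map (inside ∷_) (subsets d) ++ map (outside ∷_) (subsets d)

∈-subsets : ∀ {d} (B : Subset d) → B ∈ subsets d
∈-subsets []            = here ≡.refl
∈-subsets (inside  ∷ B) = ∈-++⁺ˡ (∈-map⁺ (inside ∷_) (∈-subsets B))
∈-subsets (outside ∷ B) = ∈-++⁺ʳ (map (inside ∷_) (subsets _)) (∈-map⁺ (outside ∷_) (∈-subsets B))

weightℕ : ∀ {d} → (Fin d → ℕ) → Subset d → ℕ
weightℕ f []      = 0
weightℕ f (b ∷ B) = (if b then f zero else 0) ℕ.+ weightℕ (f ∘ suc) B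

-- The weight of C under this function is the number of elements of C outside B.
avoiding : ∀ {d} → Subset d → Fin d → ℕ
avoiding B i = if lookup B i then 0 else 1

weightℕ-linear : ∀ {d} N (f h : Fin d → ℕ) C →
                 weightℕ (λ i → N ℕ.* f i ℕ.+ h i) C ≡ N ℕ.* weightℕ f C ℕ.+ weightℕ h C
weightℕ-linear N f h []            = ≡.sym (≡.trans (ℕₚ.+-identityʳ _) (ℕₚ.*-zeroʳ N))
weightℕ-linear N f h (outside ∷ C) = weightℕ-linear N (f ∘ suc) (h ∘ suc) C
weightℕ-linear N f h (inside  ∷ C) = begin
  N ℕ.* f zero ℕ.+ h zero ℕ.+ weightℕ (λ i → N ℕ.* f (suc i) ℕ.+ h (suc i)) C
    ≡⟨ cong (N ℕ.* f zero ℕ.+ h zero ℕ.+_) (weightℕ-linear N (f ∘ suc) (h ∘ suc) C) ⟩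
  N ℕ.* f zero ℕ.+ h zero ℕ.+ (N ℕ.* weightℕ (f ∘ suc) C ℕ.+ weightℕ (h ∘ suc) C)
    ≡⟨ interchange (N ℕ.* f zero) (h zero) _ _ ⟩
  N ℕ.* f zero ℕ.+ N ℕ.* weightℕ (f ∘ suc) C ℕ.+ (h zero ℕ.+ weightℕ (h ∘ suc) C)
    ≡⟨ cong (ℕ._+ (h zero ℕ.+ weightℕ (h ∘ suc) C)) (ℕₚ.*-distribˡ-+ N (f zero) _) ⟨
  N ℕ.* (f zero ℕ.+ weightℕ (f ∘ suc) C) ℕ.+ (h zero ℕ.+ weightℕ (h ∘ suc) C) ∎
  where
  open ≡-Reasoning
  open CommutativeSemigroupProperties ℕₚ.+-commutativeSemigroup using (interchange)

weight-avoiding-self : ∀ {d} (B : Subset d) → weightℕ (avoiding B) B ≡ 0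
weight-avoiding-self []            = ≡.refl
weight-avoiding-self (outside ∷ B) = weight-avoiding-self B
weight-avoiding-self (inside  ∷ B) = weight-avoiding-self B

weight-avoiding-≤ : ∀ {d} (B C : Subset d) → weightℕ (avoiding B) C ℕ.≤ d
weight-avoiding-≤ []            []            = z≤n
weight-avoiding-≤ (b       ∷ B) (outside ∷ C) = ℕₚ.m≤n⇒m≤1+n (weight-avoiding-≤ B C)
weight-avoiding-≤ (outside ∷ B) (inside  ∷ C) = s≤s (weight-avoiding-≤ B C)
weight-avoiding-≤ (inside  ∷ B) (inside  ∷ C) = ℕₚ.m≤n⇒m≤1+n (weight-avoiding-≤ B C)

avoiding≡0⇒weight-≤ : ∀ {d} (f : Fin d → ℕ) (B C : Subset d) →
                      weightℕ (avoiding B) C ≡ 0 → weightℕ f C ℕ.≤ weightℕ f B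
avoiding≡0⇒weight-≤ f []            []            _ = z≤n
avoiding≡0⇒weight-≤ f (b       ∷ B) (outside ∷ C) p =
  ℕₚ.m≤n⇒m≤o+n _ (avoiding≡0⇒weight-≤ (f ∘ suc) B C p)
avoiding≡0⇒weight-≤ f (inside  ∷ B) (inside  ∷ C) p =
  ℕₚ.+-monoʳ-≤ (f zero) (avoiding≡0⇒weight-≤ (f ∘ suc) B C p)

-- The first equation says that C lies inside B; an element of B missing from C would then make C
-- strictly lighter.
avoiding≡0⇒≡ : ∀ {d} (f : Fin d → ℕ) → (∀ i → 0 ℕ.< f i) → (B C : Subset d) →
               weightℕ (avoiding B) C ≡ 0 → weightℕ f C ≡ weightℕ f B → C ≡ B
avoiding≡0⇒≡ f 0<f []            []            _ _ = ≡.refl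
avoiding≡0⇒≡ f 0<f (outside ∷ B) (outside ∷ C) p q = cong (outside ∷_)
  (avoiding≡0⇒≡ (f ∘ suc) (0<f ∘ suc) B C p q)
avoiding≡0⇒≡ f 0<f (inside  ∷ B) (inside  ∷ C) p q = cong (inside ∷_)
  (avoiding≡0⇒≡ (f ∘ suc) (0<f ∘ suc) B C p (ℕₚ.+-cancelˡ-≡ (f zero) _ _ q))
-- Here an element of B is missing from C, and positivity of f at this element contradicts the
-- equality of weights.
avoiding≡0⇒≡ f 0<f (inside  ∷ B) (outside ∷ C) p q = contradiction
  (ℕₚ.≤-<-trans (avoiding≡0⇒weight-≤ (f ∘ suc) B C p) (ℕₚ.m<n+m (weightℕ (f ∘ suc) B) (0<f zero)))
  (ℕₚ.<-irrefl q)

-- Since weightℕ (avoiding B) takes values in 0 … d, this weight compares subsets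
-- by f first and by the number of elements outside B second.
tilt : ∀ {d} → (Fin d → ℕ) → Subset d → Fin d → ℕ
tilt {d} f B i = suc d ℕ.* f i ℕ.+ avoiding B i

module _ {d} (f : Fin d → ℕ) (B : Subset d) where

  tilt-weight : ∀ C → weightℕ (tilt f B) C ≡ suc d ℕ.* weightℕ f C ℕ.+ weightℕ (avoiding B) C
  tilt-weight = weightℕ-linear (suc d) f (avoiding B)

  tilt-weight-self : weightℕ (tilt f B) B ≡ suc d ℕ.* weightℕ f B
  tilt-weight-self = ≡.trans (tilt-weight B)
    (≡.trans (cong (suc d ℕ.* weightℕ f B ℕ.+_) (weight-avoiding-self B)) (ℕₚ.+-identityʳ _))

  tilt-≤⇒≤ : ∀ C → weightℕ (tilt f B) C ℕ.≤ weightℕ (tilt f B) B → weightℕ f C ℕ.≤ weightℕ f B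
  tilt-≤⇒≤ C le rewrite tilt-weight C | tilt-weight-self =
    ℕₚ.*-cancelˡ-≤ (suc d) (ℕₚ.m+n≤o⇒m≤o _ le)

  -- The equal f-weights cancel, which leaves at most 0 elements of C outside B.
  tilt-≤∧≡⇒≡ : (∀ i → 0 ℕ.< f i) → ∀ C → weightℕ (tilt f B) C ℕ.≤ weightℕ (tilt f B) B →
               weightℕ f C ≡ weightℕ f B → C ≡ B
  tilt-≤∧≡⇒≡ 0<f C le eq rewrite tilt-weight C | tilt-weight-self | eq =
    avoiding≡0⇒≡ f 0<f B C (ℕₚ.n≤0⇒n≡0 (ℕₚ.+-cancelˡ-≤ (suc d ℕ.* weightℕ f B) _ 0
      (ℕₚ.≤-trans le (ℕₚ.≤-reflexive (≡.sym (ℕₚ.+-identityʳ _)))))) eq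

  -- A difference of at least 1 in f counts at least d + 1, more than the at most d that elements
  -- outside B can add.
  <⇒tilt-< : ∀ C → weightℕ f C ℕ.< weightℕ f B → weightℕ (tilt f B) C ℕ.< weightℕ (tilt f B) B
  <⇒tilt-< C lt rewrite tilt-weight C | tilt-weight-self = begin-strict
    suc d ℕ.* weightℕ f C ℕ.+ weightℕ (avoiding B) C
      <⟨ ℕₚ.+-monoʳ-< (suc d ℕ.* weightℕ f C) (s≤s (weight-avoiding-≤ B C)) ⟩
    suc d ℕ.* weightℕ f C ℕ.+ suc d
      ≡⟨ ℕₚ.+-comm _ (suc d) ⟩
    suc d ℕ.+ suc d ℕ.* weightℕ f C
      ≡⟨ ℕₚ.*-suc (suc d) (weightℕ f C) ⟨
    suc d ℕ.* suc (weightℕ f C)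
      ≤⟨ ℕₚ.*-monoʳ-≤ (suc d) lt ⟩
    suc d ℕ.* weightℕ f B ∎
    where open ℕₚ.≤-Reasoning

  tilt-≡⇒≡ : (∀ i → 0 ℕ.< f i) → ∀ C → weightℕ (tilt f B) C ≡ weightℕ (tilt f B) B → C ≡ B
  tilt-≡⇒≡ 0<f C eq with weightℕ f C ℕₚ.<? weightℕ f B
  ... | yes lt = contradiction (<⇒tilt-< C lt) (ℕₚ.<-irrefl eq)
  ... | no ≮  = tilt-≤∧≡⇒≡ 0<f C (ℕₚ.≤-reflexive eq)
    (ℕₚ.≤-antisym (tilt-≤⇒≤ C (ℕₚ.≤-reflexive eq)) (ℕₚ.≮⇒≥ ≮))

-- Natural numbers and integers in the ordered field

module _ (ℝ : CompleteOrderedField) where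
  open OrderedField ℝ
  open Mult +-monoid using (×-homo-+)

  fromℕ-+ : ∀ m n → fromℕ ℝ (m ℕ.+ n) ≈ fromℕ ℝ m + fromℕ ℝ n
  fromℕ-+ m n = ×-homo-+ 1# m n

  -- This moves comparisons of weights to ℕ, where distinct weights differ by at least 1, as the
  -- tilt requires.
  weight-fromℕ : ∀ {d} (f : Fin d → ℕ) B → weight ℝ (fromℕ ℝ ∘ f) B ≈ fromℕ ℝ (weightℕ f B)
  weight-fromℕ f []            = refl
  weight-fromℕ f (outside ∷ B) = trans (+-identityˡ _) (weight-fromℕ (f ∘ suc) B)
  weight-fromℕ f (inside  ∷ B) = trans (+-congˡ (weight-fromℕ (f ∘ suc) B))
    (sym (fromℕ-+ (f zero) (weightℕ (f ∘ suc) B)))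

  module _ {d} (f : Fin d → ℕ) (B C : Subset d) where

    weight-mono-≤ : weightℕ f B ℕ.≤ weightℕ f C →
                    weight ℝ (fromℕ ℝ ∘ f) B ≤ weight ℝ (fromℕ ℝ ∘ f) C
    weight-mono-≤ le = ≤-respˡ-≈ (sym (weight-fromℕ f B))
      (≤-respʳ-≈ (sym (weight-fromℕ f C)) (fromℕ-mono-≤ ℝ le))

    weight-cancel-≤ : weight ℝ (fromℕ ℝ ∘ f) B ≤ weight ℝ (fromℕ ℝ ∘ f) C →
                      weightℕ f B ℕ.≤ weightℕ f C
    weight-cancel-≤ le = fromℕ-cancel-≤ ℝ _ _
      (≤-respˡ-≈ (weight-fromℕ f B) (≤-respʳ-≈ (weight-fromℕ f C) le))

  fromℤ : ℤ → Carrier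
  fromℤ (+ n)    = fromℕ ℝ n
  fromℤ -[1+ n ] = - fromℕ ℝ (suc n)

  fromℤ-⊖ : ∀ m n → fromℤ (m ℤ.⊖ n) ≈ fromℕ ℝ m + - fromℕ ℝ n
  fromℤ-⊖ zero    zero    = sym (trans (+-identityˡ _) -0#≈0#)
  fromℤ-⊖ zero    (suc n) = sym (+-identityˡ _)
  fromℤ-⊖ (suc m) zero    = sym (trans (+-congˡ -0#≈0#) (+-identityʳ _))
  fromℤ-⊖ (suc m) (suc n) = begin
    fromℤ (suc m ℤ.⊖ suc n)                           ≡⟨ cong fromℤ (ℤₚ.[1+m]⊖[1+n]≡m⊖n m n) ⟩
    fromℤ (m ℤ.⊖ n)                                   ≈⟨ fromℤ-⊖ m n ⟩
    fromℕ ℝ m + - fromℕ ℝ n                           ≈⟨ +-identityˡ _ ⟨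
    0# + (fromℕ ℝ m + - fromℕ ℝ n)                    ≈⟨ +-congʳ (-‿inverseʳ 1#) ⟨
    1# + - 1# + (fromℕ ℝ m + - fromℕ ℝ n)             ≈⟨ interchange _ _ _ _ ⟩
    1# + fromℕ ℝ m + (- 1# + - fromℕ ℝ n)             ≈⟨ +-congˡ (-‿+-comm _ _) ⟩
    1# + fromℕ ℝ m + - (1# + fromℕ ℝ n)               ∎
    where
    open ≈-Reasoning setoid
    open CommutativeSemigroupProperties +-commutativeSemigroup using (interchange)

  fromℤ-+ : ∀ a b → fromℤ (a ℤ.+ b) ≈ fromℤ a + fromℤ b
  fromℤ-+ (+ m)    (+ n)    = fromℕ-+ m n
  fromℤ-+ (+ m)    -[1+ n ] = fromℤ-⊖ m (suc n)
  fromℤ-+ -[1+ m ] (+ n)    = trans (fromℤ-⊖ n (suc m)) (+-comm _ _)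
  fromℤ-+ -[1+ m ] -[1+ n ] = begin
    - fromℕ ℝ (suc (suc (m ℕ.+ n)))            ≡⟨ cong (λ k → - fromℕ ℝ (suc k)) (ℕₚ.+-suc m n) ⟨
    - fromℕ ℝ (suc m ℕ.+ suc n)                ≈⟨ -‿cong (fromℕ-+ (suc m) (suc n)) ⟩
    - (fromℕ ℝ (suc m) + fromℕ ℝ (suc n))      ≈⟨ -‿+-comm _ _ ⟨
    - fromℕ ℝ (suc m) + - fromℕ ℝ (suc n)      ∎
    where open ≈-Reasoning setoid

  fromℤ-neg : ∀ a → fromℤ (ℤ.- a) ≈ - fromℤ a
  fromℤ-neg (+ zero)    = sym -0#≈0#
  fromℤ-neg (+ (suc n)) = refl
  fromℤ-neg -[1+ n ]    = sym (-‿involutive _)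

-- Matroid base polytopes

module BasePolytopes (em : ExcludedMiddle 0ℓ) (ℝ : CompleteOrderedField) where
  open OrderedField ℝ
  open Polytopes em ℝ
  open Polytope
  open Cones.Functional
  open SumProperties +-commutativeMonoid using (sum)

  coordinate : ∀ {n} → Fin n → C.Functional n
  coordinate zero    = record
    { ⟦_⟧ = proj₁ ; ⟦⟧-cong = proj₁ ; ⟦⟧-zero = refl ; ⟦⟧-ray = λ _ _ _ → refl }
  coordinate (suc i) = record
    { ⟦_⟧     = λ v → ⟦ coordinate i ⟧ (proj₂ v)
    ; ⟦⟧-cong = λ e → ⟦⟧-cong (coordinate i) (proj₂ e)
    ; ⟦⟧-zero = ⟦⟧-zero (coordinate i)
    ; ⟦⟧-ray  = λ k p u → ⟦⟧-ray (coordinate i) k (proj₂ p) (proj₂ u)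
    }

  coordinate-point : ∀ {n} i m x → ⟦ coordinate {n} i ⟧ (point n m x) ≡ x i
  coordinate-point zero    m x = ≡.refl
  coordinate-point (suc i) m x = coordinate-point i m (x ∘ suc)

  dot : ∀ n → (Fin n → Carrier) → C.Functional n
  dot zero    g = record
    { ⟦_⟧ = λ _ → 0# ; ⟦⟧-cong = λ _ → refl ; ⟦⟧-zero = refl
    ; ⟦⟧-ray = λ k _ _ → sym (trans (+-identityʳ _) (zeroʳ k)) }
  dot (suc n) g = record
    { ⟦_⟧     = λ v → g zero * proj₁ v + ⟦ dot n (g ∘ suc) ⟧ (proj₂ v)
    ; ⟦⟧-cong = λ e → +-cong (*-congˡ (proj₁ e)) (⟦⟧-cong (dot n (g ∘ suc)) (proj₂ e))
    ; ⟦⟧-zero = trans (+-cong (zeroʳ _) (⟦⟧-zero (dot n (g ∘ suc)))) (+-identityˡ _)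
    ; ⟦⟧-ray  = λ k (x , p) (y , u) → trans
        (+-cong (trans (distribˡ _ _ _) (+-congʳ (x∙yz≈y∙xz _ k x)))
                (⟦⟧-ray (dot n (g ∘ suc)) k p u))
        (trans (interchange _ _ _ _) (+-congʳ (sym (distribˡ k _ _))))
    }
    where
    open CommutativeSemigroupProperties +-commutativeSemigroup using (interchange)
    open CommutativeSemigroupProperties *-commutativeSemigroup using (x∙yz≈y∙xz)

  point-zero : ∀ n {m x} → m ≈ 0# → (∀ i → x i ≈ 0#) → V._≈ᴹ_ n (point n m x) (V.0ᴹ n)
  point-zero zero    m≈0 x≈0 = m≈0
  point-zero (suc n) m≈0 x≈0 = x≈0 zero , point-zero n m≈0 (x≈0 ∘ suc)

  point-ray : ∀ n {k l m m′ x y p} → m ≈ k * l + m′ → (∀ i → x i ≈ k * p i + y i) →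
              V._≈ᴹ_ n (point n m x) (V._+ᴹ_ n (V._*ₗ_ n k (point n l p)) (point n m′ y))
  point-ray zero    m≈ x≈ = m≈
  point-ray (suc n) m≈ x≈ = x≈ zero , point-ray n m≈ (x≈ ∘ suc)

  vertex : ∀ {d} → Subset d → V.Carrierᴹ d
  vertex {d} B = point d 1# (indicatorVector ℝ B)

  mass-vertex : ∀ {d} (B : Subset d) → ⟦ mass d ⟧ (vertex B) ≈ 1#
  mass-vertex {d} B = mass-point d 1# (indicatorVector ℝ B)

  dot-vertex : ∀ {d} g (B : Subset d) → ⟦ dot d g ⟧ (vertex B) ≈ weight ℝ g B
  dot-vertex g []            = refl
  dot-vertex g (inside  ∷ B) = +-cong (*-identityʳ _) (dot-vertex (g ∘ suc) B)
  dot-vertex g (outside ∷ B) = +-cong (zeroʳ _) (dot-vertex (g ∘ suc) B)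

  module _ {d} (M : Matroid d) where

    bases : List (Subset d)
    bases = filter (T? ∘ basis? M) (subsets d)

    ∈-bases⁺ : ∀ {B} → IsBasis M B → B ∈ bases
    ∈-bases⁺ {B} bB = ∈-filter⁺ (T? ∘ basis? M) (∈-subsets B) bB

    ∈-bases⁻ : ∀ {B} → B ∈ bases → IsBasis M B
    ∈-bases⁻ B∈ = proj₂ (∈-filter⁻ (T? ∘ basis? M) {xs = subsets d} B∈)

    private
      massive-vertex : ∀ (B : Subset d) → 0# < ⟦ mass d ⟧ (vertex B)
      massive-vertex B m≤0 = 0<1 (≤-respˡ-≈ (mass-vertex B) m≤0)

      Vertex : Pred (V.Carrierᴹ d) 0ℓ
      Vertex v = ∃[ B ] IsBasis M B × v ≡ vertex B

    -- By `dot-vertex` this is the graph of the functional `dot d g` over the base polytope, so its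
    -- top level is the maximum of g over the bases.
    lifted : (Fin d → Carrier) → Polytope (suc d)
    lifted g = hull (map (λ B → weight ℝ g B , vertex B) bases) massive-lifted
      where
      massive-lifted : ∀ {p} → p ∈ map (λ B → weight ℝ g B , vertex B) bases →
                       0# < ⟦ mass (suc d) ⟧ p
      massive-lifted p∈ with ∈-map⁻ _ p∈
      ... | B , _ , ≡.refl = massive-vertex B

    private
      -- `evaluate` holds for all functionals at once: the mass gives the sum of the coefficients,
      -- and the coordinates give the convex combination.
      record Decomposition (u : V.Carrierᴹ d) : Set where
        field
          size        : ℕ
          basis       : Fin size → Subset d
          coefficient : Fin size → Carrier
          isBasis     : ∀ k → IsBasis M (basis k)
          nonneg      : ∀ k → 0# ≤ coefficient k
          evaluate    : (φ : C.Functional d) →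
                        ⟦ φ ⟧ u ≈ sum λ k → coefficient k * ⟦ φ ⟧ (vertex (basis k))

      decompose : ∀ {u} → C.Cone d Vertex u → Decomposition u
      decompose (C.apex u≈0) = record
        { size = 0 ; basis = λ () ; coefficient = λ () ; isBasis = λ () ; nonneg = λ ()
        ; evaluate = λ φ → trans (⟦⟧-cong φ u≈0) (⟦⟧-zero φ) }
      decompose (C.ray {k} 0≤k (B , bB , ≡.refl) c e) = record
        { size        = suc size
        ; basis       = B Vector.∷ basis
        ; coefficient = k Vector.∷ coefficient
        ; isBasis     = λ { zero → bB ; (suc i) → isBasis i }
        ; nonneg      = λ { zero → 0≤k ; (suc i) → nonneg i }
        ; evaluate    = λ φ → trans (C.Functional.⟦⟧-ray-≈ d φ e) (+-congˡ (evaluate φ))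
        }
        where open Decomposition (decompose c)

      -- The mass m is arbitrary because the coefficients left after removing the first point need
      -- not sum to 1.
      compose : ∀ n {m x} (p : Fin n → Fin d → Carrier) (a : Fin n → Carrier) →
                (∀ k → ∃[ B ] IsBasis M B × (∀ i → p k i ≈ indicatorVector ℝ B i)) →
                (∀ k → 0# ≤ a k) → m ≈ sum a → (∀ i → x i ≈ sum λ k → a k * p k i) →
                C.Cone d Vertex (point d m x)
      compose zero    p a p∈ 0≤a m≈ x≈ = C.apex {d} (point-zero d m≈ x≈)
      compose (suc n) p a p∈ 0≤a m≈ x≈ with p∈ zero
      ... | B , bB , p₀≈ = C.ray {d} (0≤a zero) (B , bB , ≡.refl)
        (compose n (p ∘ suc) (a ∘ suc) (p∈ ∘ suc) (0≤a ∘ suc) refl (λ _ → refl))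
        (point-ray d (trans m≈ (+-congʳ (sym (*-identityʳ _))))
                     (λ i → trans (x≈ i) (+-congʳ (*-congˡ (p₀≈ i)))))

    Member-base⁻ : ∀ {x} → C.Cone d Vertex (point d 1# x) → BasePolytope ℝ M x
    Member-base⁻ {x} c = record
      { size        = size
      ; point       = λ k → indicatorVector ℝ (basis k)
      ; coefficient = coefficient
      ; point∈S     = λ k → basis k , isBasis k , λ _ → refl
      ; nonneg      = nonneg
      ; sum≈1       = trans
          (sum-cong-≋ λ k → trans (sym (*-identityʳ _)) (*-congˡ (sym (mass-vertex (basis k)))))
          (trans (sym (evaluate (mass d))) (mass-point d 1# x))
      ; combination = λ i → trans (reflexive (≡.sym (coordinate-point i 1# x)))
          (trans (evaluate (coordinate i))
            (sum-cong-≋ λ k → *-congˡ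
              (reflexive (coordinate-point i 1# (indicatorVector ℝ (basis k))))))
      }
      where
      open Decomposition (decompose c)
      open SumProperties +-commutativeMonoid using (sum-cong-≋)

    Member-base⁺ : ∀ {x} → BasePolytope ℝ M x → C.Cone d Vertex (point d 1# x)
    Member-base⁺ c = compose size point′ coefficient point∈S nonneg (sym sum≈1) combination
      where open Conv c renaming (point to point′)

    module _ (g : Fin d → Carrier) (y : Fin (suc d) → Carrier) where

      Member-lifted⁻ : Member y (lifted g) →
                       y zero ≈ ⟦ dot d g ⟧ (point d 1# (y ∘ suc)) × BasePolytope ℝ M (y ∘ suc)
      Member-lifted⁻ c =
        gap≈0⇒ d (dot d g) (point (suc d) 1# y)
          (C.Functional.cone-zero (suc d) (gap d (dot d g)) on-graph c) ,
        Member-base⁻ (cone-proj₂ d is-vertex c)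
        where
        on-graph : ∀ {p} → p ∈ generators (lifted g) → ⟦ gap d (dot d g) ⟧ p ≈ 0#
        on-graph p∈ with ∈-map⁻ _ p∈
        ... | B , _ , ≡.refl = gap≈0⇐ d (dot d g) _ (sym (dot-vertex g B))
        is-vertex : ∀ {p} → p ∈ generators (lifted g) → Vertex (proj₂ p)
        is-vertex p∈ with ∈-map⁻ _ p∈
        ... | B , B∈ , ≡.refl = B , ∈-bases⁻ B∈ , ≡.refl

      Member-lifted⁺ : y zero ≈ ⟦ dot d g ⟧ (point d 1# (y ∘ suc)) → BasePolytope ℝ M (y ∘ suc) →
                       Member y (lifted g)
      Member-lifted⁺ y₀≈ y∈ = C.cone-resp-≈ (suc d) (sym y₀≈ , V.≈ᴹ-refl d)
        (cone-graph d (dot d g) lift (Member-base⁺ y∈))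
        where
        lift : ∀ {v} → Vertex v → C.Cone (suc d) (_∈ generators (lifted g)) (⟦ dot d g ⟧ v , v)
        lift (B , bB , ≡.refl) = C.cone-resp-≈ (suc d) (sym (dot-vertex g B) , V.≈ᴹ-refl d)
          (C.cone-gen (suc d) (∈-map⁺ _ (∈-bases⁺ bB)))

    module _ (g : Fin d → Carrier) (c : Carrier) where

      private
        c*mass : ∀ (B : Subset d) → c * ⟦ mass d ⟧ (vertex B) ≈ c
        c*mass B = trans (*-congˡ (mass-vertex B)) (*-identityʳ c)

      Top-lifted⁻ : Top c (lifted g) → (∃[ B ] IsBasis M B × weight ℝ g B ≈ c) ×
                                       (∀ {B} → IsBasis M B → weight ℝ g B ≤ c)
      Top-lifted⁻ ((p , p∈ , p≈0) , max) with ∈-map⁻ _ p∈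
      ... | B , B∈ , ≡.refl =
        (B , ∈-bases⁻ B∈ , trans (gap≈0⇒ d (scale d c (mass d)) _ p≈0) (c*mass B)) ,
        λ {A} bA → +-cancelʳ-≤ ℝ (- (c * ⟦ mass d ⟧ (vertex A)))
          (≤-respʳ-≈ (sym (trans (+-congʳ (sym (c*mass A))) (-‿inverseʳ _)))
            (max (∈-map⁺ _ (∈-bases⁺ bA))))

      Top-lifted⁺ : ∀ {B} → IsBasis M B → weight ℝ g B ≈ c →
                    (∀ {B} → IsBasis M B → weight ℝ g B ≤ c) → Top c (lifted g)
      Top-lifted⁺ {B} bB gB≈c max =
        (_ , ∈-map⁺ _ (∈-bases⁺ bB) ,
         gap≈0⇐ d (scale d c (mass d)) _ (trans gB≈c (sym (c*mass B)))) , below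
        where
        below : ∀ {p} → p ∈ generators (lifted g) → ⟦ height d c ⟧ p ≤ 0#
        below p∈ with ∈-map⁻ _ p∈
        ... | A , A∈ , ≡.refl = ≤-respʳ-≈ (trans (+-congʳ (sym (c*mass A))) (-‿inverseʳ _))
          (+-monoˡ-≤ ℝ _ (max (∈-bases⁻ A∈)))

    -- `Generic` unfolds to the existence of such a B, which is the form that `∑-∃` takes.
    UniqueMax : (Fin d → ℕ) → Pred (Subset d) 0ℓ
    UniqueMax f B = IsMaxBasis ℝ M (fromℕ ℝ ∘ f) B ×
                    (∀ {C} → IsMaxBasis ℝ M (fromℕ ℝ ∘ f) C → B ≡ C)

    module _ (f : Fin d → ℕ) (0<f : ∀ i → 0 ℕ.< f i) (B : Subset d) where

      private
        g : Fin d → Carrier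
        g = fromℕ ℝ ∘ tilt f B

      -- The top is attained at a basis A with g (A) = g (B), so A = B by `tilt-≡⇒≡` and B is a
      -- basis. A further f-maximal C ties with B in f without exceeding it in g, which forces C =
      -- B.
      Top⇒UniqueMax : Top (weight ℝ g B) (lifted g) → UniqueMax f B
      Top⇒UniqueMax top with Top-lifted⁻ g (weight ℝ g B) top
      ... | (A , bA , gA≈gB) , max = (bB , maxB) , unique
        where
        A≡B : A ≡ B
        A≡B = tilt-≡⇒≡ f B 0<f A (ℕₚ.≤-antisym
          (weight-cancel-≤ ℝ (tilt f B) A B (≤-reflexive gA≈gB))
          (weight-cancel-≤ ℝ (tilt f B) B A (≤-reflexive (sym gA≈gB))))
        bB : IsBasis M B
        bB = ≡.subst (IsBasis M) A≡B bA
        tilt-≤ : ∀ {C} → IsBasis M C → weightℕ (tilt f B) C ℕ.≤ weightℕ (tilt f B) B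
        tilt-≤ {C} bC = weight-cancel-≤ ℝ (tilt f B) C B (max bC)
        maxB : ∀ {C} → IsBasis M C → weight ℝ (fromℕ ℝ ∘ f) C ≤ weight ℝ (fromℕ ℝ ∘ f) B
        maxB {C} bC = weight-mono-≤ ℝ f C B (tilt-≤⇒≤ f B C (tilt-≤ bC))
        unique : ∀ {C} → IsMaxBasis ℝ M (fromℕ ℝ ∘ f) C → B ≡ C
        unique {C} (bC , maxC) = ≡.sym (tilt-≤∧≡⇒≡ f B 0<f C (tilt-≤ bC) (ℕₚ.≤-antisym
          (tilt-≤⇒≤ f B C (tilt-≤ bC)) (weight-cancel-≤ ℝ f B C (maxC bB))))

      UniqueMax⇒Top : UniqueMax f B → Top (weight ℝ g B) (lifted g)
      UniqueMax⇒Top ((bB , maxB) , unique) = Top-lifted⁺ g (weight ℝ g B) bB refl max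
        where
        max : ∀ {C} → IsBasis M C → weight ℝ g C ≤ weight ℝ g B
        max {C} bC with weightℕ f C ℕₚ.<? weightℕ f B
        ... | yes lt = weight-mono-≤ ℝ (tilt f B) C B (ℕₚ.<⇒≤ (<⇒tilt-< f B C lt))
        -- A basis that is not f-lighter than B is f-maximal itself, hence equal to B.
        ... | no ≮  = ≤-reflexive (reflexive (cong (weight ℝ g) (≡.sym (unique
          (bC , λ {D} bD → ≤-trans (maxB bD) (weight-mono-≤ ℝ f B C (ℕₚ.≮⇒≥ ≮)))))))

  -- Relations between base polytopes

  module _ {d} (L : List (ℤ × Matroid d))
           (relation : ∀ x → ∑ em L (λ M → BasePolytope ℝ M x) ≡ 0ℤ) where

    private
      liftedL : (Fin d → Carrier) → List (ℤ × Polytope (suc d))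
      liftedL g = map (map₂ λ M → lifted M g) L

    -- Whether y lies on the graph of `dot d g` does not depend on the matroid: off the graph all
    -- terms vanish, and on it the given relation applies to the remaining coordinates.
    lifted-relation : ∀ g y → ∑ em (liftedL g) (Member y) ≡ 0ℤ
    lifted-relation g y with em {y zero ≈ ⟦ dot d g ⟧ (point d 1# (y ∘ suc))}
    ... | yes y₀≈ = ≡.trans (∑-map em (λ M → lifted M g) {Member y} L) (≡.trans
      (∑-cong em L (λ {M} c → proj₂ (Member-lifted⁻ M g y c)) (λ {M} → Member-lifted⁺ M g y y₀≈))
      (relation (y ∘ suc)))
    ... | no y₀≉  = ≡.trans (∑-map em (λ M → lifted M g) {Member y} L)
      (∑-empty em L λ {M} c → y₀≉ (proj₁ (Member-lifted⁻ M g y c)))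

    ∑-Top-lifted : ∀ g c → ∑ em L (λ M → Top c (lifted M g)) ≡ 0ℤ
    ∑-Top-lifted g c = ≡.trans (≡.sym (∑-map em (λ M → lifted M g) {Top c} L))
      (∑-Top (liftedL g) (∑-Inhabited-slice d (liftedL g) (lifted-relation g)) c)

    ∑-Generic : (f : Fin d → ℕ) → (∀ i → 0 ℕ.< f i) → ∑ em L (λ M → Generic ℝ M (fromℕ ℝ ∘ f)) ≡ 0ℤ
    ∑-Generic f 0<f = ∑-∃ em (λ B M → UniqueMax M f B)
      -- Two unique maximal bases of the same M are equal, so their classes coincide for every
      -- matroid.
      (λ { {x = M} (max , _) (_ , unique) {N} → ≡.subst (UniqueMax N f) (≡.sym (unique max)) })
      L λ B → ≡.trans
        (∑-cong em L (λ {M} → UniqueMax⇒Top M f 0<f B) (λ {M} → Top⇒UniqueMax M f 0<f B))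
        (∑-Top-lifted (fromℕ ℝ ∘ tilt f B) _)

-- The homomorphism on polytope indicators

module _ (em : ExcludedMiddle 0ℓ) (ℝ : CompleteOrderedField) where
  private
    module ℝ = CompleteOrderedField ℝ
    module PS d = AbelianGroup (PS[_] em ℝ d)
    module WQSym d = LeftModule (WQSym[_] em ℝ d)
  open FinitelySupported
  open WordQuasisymmetric

  InPS : ∀ d → (ℝ^ ℝ d → ℤ) → Set
  InPS d = Generated (Pointwise.abelianGroup (ℝ^ ℝ d) ℤₚ.+-0-abelianGroup)
                     (IsPolytopeIndicator em ℝ d)

  -- The list reflects how h was generated, and several lists may belong to one function;
  -- `genericCount-cong` shows that the resulting count depends on the function alone.
  terms : ∀ {d h} → InPS d h → List (ℤ × Matroid d)
  terms (generator (M , _)) = (1ℤ , M) ∷ []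
  terms ε-closed            = []
  terms (∙-closed p q)      = terms p ++ terms q
  terms (⁻¹-closed p)       = map (map₁ λ a → ℤ.- a) (terms p)
  terms (≈-closed _ p)      = terms p

  ∑-terms : ∀ {d h} (p : InPS d h) x → ∑ em (terms p) (λ M → BasePolytope ℝ M x) ≡ h x
  ∑-terms (generator (M , h≡)) x = ≡.trans (ℤₚ.+-identityʳ _) (≡.sym (h≡ x))
  ∑-terms ε-closed             x = ≡.refl
  ∑-terms (∙-closed p q)       x = ≡.trans (∑-++ em (terms p) (terms q))
    (cong₂ ℤ._+_ (∑-terms p x) (∑-terms q x))
  ∑-terms (⁻¹-closed p)        x = ≡.trans (∑-neg em (terms p)) (cong (λ a → ℤ.- a) (∑-terms p x))
  ∑-terms (≈-closed h≡ p)      x = ≡.trans (∑-terms p x) (h≡ x)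

  genericCount : ∀ {d h} → InPS d h → (Fin d → ℕ⁺) → ℤ
  genericCount p f = ∑ em (terms p) (λ M → Generic ℝ M (fromℕ ℝ ∘ value ∘ f))

  genericCount-zero : ∀ {d h} (p : InPS d h) → (∀ x → h x ≡ 0ℤ) → ∀ f → genericCount p f ≡ 0ℤ
  genericCount-zero p h≡0 f = BasePolytopes.∑-Generic em ℝ (terms p)
    (λ x → ≡.trans (∑-terms p x) (h≡0 x)) (value ∘ f) (positive ∘ f)
    where
    positive : ∀ n → 0 ℕ.< value n
    positive (n , [ n≢0 ]) = ℕ.>-nonZero⁻¹ n {{n≢0}}

  -- The formal difference of the two derivations generates the zero function, which reduces the
  -- claim to `genericCount-zero`.
  genericCount-cong : ∀ {d h h′} (p : InPS d h) (q : InPS d h′) → (∀ x → h x ≡ h′ x) →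
                      ∀ f → genericCount p f ≡ genericCount q f
  genericCount-cong p q h≡h′ f = ℤₚ.i-j≡0⇒i≡j _ _ (≡.trans
    (≡.sym (≡.trans (∑-++ em (terms p) _) (cong (ℤ._+_ (genericCount p f)) (∑-neg em (terms q)))))
    (genericCount-zero (∙-closed p (⁻¹-closed q)) (λ x → ℤₚ.i≡j⇒i-j≡0 (h≡h′ x)) f))

  Ψ̂[_] : ∀ d → PS.Carrier d → WordQuasisymmetric em ℝ d
  Ψ̂[ d ] (h , p) = record
    { coefficient = λ f → fromℤ ℝ (genericCount p f)
    ; invariant   = λ f g eq → ℝ.reflexive (cong (fromℤ ℝ) (∑-cong em (terms p)
        (λ {M} → Generic-resp-setComposition ℝ em M f g eq)
        (λ {M} → Generic-resp-setComposition ℝ em M g f (≡.sym eq))))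
    }

  Ψ̂ : AbelianGroup.Carrier (PS em ℝ) → LeftModule.Carrierᴹ (WQSym em ℝ)
  Ψ̂ x = record
    { component = λ d → Ψ̂[ d ] (component x d)
    ; bound     = bound x
    -- Beyond the bound the component is zero as a function, but its derivation may still have
    -- terms.
    ; vanishes  = λ {d} b≤d f → ℝ.reflexive (cong (fromℤ ℝ)
        (genericCount-zero (proj₂ (component x d)) (vanishes x b≤d) f))
    }

  Ψ̂-polytope : ∀ d (M : Matroid d) e f →
    coefficient (component (LinearMap.⟦_⟧ (Ψ em ℝ) (matroid em ℝ M)) e) f ℝ.≈
    coefficient (component (Ψ̂ (polytope em ℝ M)) e) f
  Ψ̂-polytope d M e f with d ℕₚ.≟ e
  -- Both sides place M by the same test, so in a degree other than d both are 0.
  ... | no _ = ℝ.refl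
  ... | yes ≡.refl with em {Generic ℝ M (fromℕ ℝ ∘ value ∘ f)}
  -- The count is 1, and its image in the field unfolds to 1# + 0#.
  ...   | yes _ = ℝ.sym (ℝ.+-identityʳ _)
  ...   | no _  = ℝ.refl

corollary4p7 : (em : ExcludedMiddle 0ℓ) (ℝ : CompleteOrderedField) →
    StronglyValuative em ℝ (underlying (WQSym em ℝ)) (LinearMap.⟦_⟧ (Ψ em ℝ))
corollary4p7 em ℝ = Ψ̂ em ℝ , record
  { isMonoidHomomorphism = record
    { isMagmaHomomorphism = record
      { isRelHomomorphism = record
        { cong = λ {x} {y} x≈y d f → ℝ.reflexive (cong (fromℤ ℝ)
            (genericCount-cong em ℝ (proj₂ (component x d)) (proj₂ (component y d)) (x≈y d) f)) }
      ; homo = λ x y d f → ℝ.trans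
          (ℝ.reflexive (cong (fromℤ ℝ) (∑-++ em (terms em ℝ (proj₂ (component x d))) _)))
          (fromℤ-+ ℝ (genericCount em ℝ (proj₂ (component x d)) f) _)
      }
    ; ε-homo = λ d f → ℝ.refl
    }
  ; ⁻¹-homo = λ x d f → ℝ.trans
      (ℝ.reflexive (cong (fromℤ ℝ) (∑-neg em (terms em ℝ (proj₂ (component x d))))))
      (fromℤ-neg ℝ (genericCount em ℝ (proj₂ (component x d)) f))
  } , Ψ̂-polytope em ℝ
  where
  module ℝ = CompleteOrderedField ℝ
  open FinitelySupported
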